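{- Let $k>0$ and $r>0$ be integers and let $G$ be a biconnected graph with $\Delta(G) \ge 2kr$. Then $G$ contains $k$ edge-disjoint models of $\theta_r$.
   Context: Graphs may have multiple edges. For a vertex $v$, its degree is $|N_G(v)|$, the number of vertices adjacent to $v$, and $\Delta(G)$ is the maximum degree. $\theta_r$ is the multigraph with two vertices and $r$ parallel edges. A subgraph $H$ of $G$ is a model of $\theta_r$ if $H$ can be turned into $\theta_r$ by a sequence of edge contractions (contraction removes the edge and identifies its endpoints, keeping multiple edges). -}

module Defs where

open import Data.Nat using (ℕ; _⊔_)
open import Data.Fin using (Fin; _≟_)
open import Data.Fin.Subset using (Subset; _∈_; _-_; ∣_∣; ⊤)
open import Data.Fin.Properties using (any?)
open import Data.Product using (Σ; _×_; _,_; proj₁; proj₂; ∃)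
open import Data.Sum using (_⊎_)
open import Data.List using (List; foldr; map; allFin)
open import Data.Vec using (tabulate)
open import Relation.Nullary using (¬_; does; yes; no)
open import Relation.Nullary.Decidable using (_⊎-dec_; _×-dec_)
open import Relation.Binary.PropositionalEquality using (_≡_; _≢_)
open import Relation.Binary.Construct.Closure.ReflexiveTransitive using (Star)

-- A finite loopless multigraph: vertices Fin n, edges Fin m (parallel edges allowed).
record Graph : Set where
  field
    n        : ℕ
    m        : ℕ
    ends     : Fin m → Fin n × Fin n
    loopless : ∀ e → proj₁ (ends e) ≢ proj₂ (ends e)
open Graph public

Joins : (G : Graph) → Fin (m G) → Fin (n G) → Fin (n G) → Set
Joins G e u v = (proj₁ (ends G e) ≡ u × proj₂ (ends G e) ≡ v)
              ⊎ (proj₁ (ends G e) ≡ v × proj₂ (ends G e) ≡ u)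

Nbhd : (G : Graph) → Fin (n G) → Subset (n G)
Nbhd G v = tabulate λ u → does (any? λ e →
  ((proj₁ (ends G e) ≟ u) ×-dec (proj₂ (ends G e) ≟ v))
  ⊎-dec ((proj₁ (ends G e) ≟ v) ×-dec (proj₂ (ends G e) ≟ u)))

deg : (G : Graph) → Fin (n G) → ℕ
deg G v = ∣ Nbhd G v ∣

-- maximum degree (0 for the empty graph)
Δ : Graph → ℕ
Δ G = foldr _⊔_ 0 (map (deg G) (allFin (n G)))

data Path (G : Graph) (S : Subset (n G)) : Fin (n G) → Fin (n G) → Set where
  here : ∀ {u} → Path G S u u
  step : ∀ {u x w} (e : Fin (m G)) → Joins G e u x → x ∈ S → Path G S x w → Path G S u w

ConnectedOn : (G : Graph) → Subset (n G) → Set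
ConnectedOn G S = ∀ u w → u ∈ S → w ∈ S → Path G S u w

Biconnected : Graph → Set
Biconnected G = ConnectedOn G ⊤ × (∀ v → ConnectedOn G (⊤ - v))

record Subgraph (G : Graph) : Set where
  field
    VH     : Subset (n G)
    EH     : Subset (m G)
    closed : ∀ e → e ∈ EH → proj₁ (ends G e) ∈ VH × proj₂ (ends G e) ∈ VH
open Subgraph public

-- intermediate multigraphs during contraction (loops may appear), over G's names
record MState (G : Graph) : Set where
  constructor mstate
  field
    Vs : Subset (n G)
    Es : Subset (m G)
    en : Fin (m G) → Fin (n G) × Fin (n G)

rename : ∀ {N} → Fin N → Fin N → Fin N → Fin N
rename a b x with x ≟ b
... | yes _ = a
... | no  _ = x

-- one edge contraction: remove e and identify its endpoints (keeping multiple edges)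
data Contract (G : Graph) : MState G → MState G → Set where
  contractLoop : ∀ {Vs Es en} (e : Fin (m G)) → e ∈ Es →
    proj₁ (en e) ≡ proj₂ (en e) →
    Contract G (mstate Vs Es en) (mstate Vs (Es - e) en)
  contractEdge : ∀ {Vs Es en} (e : Fin (m G)) → e ∈ Es →
    proj₁ (en e) ≢ proj₂ (en e) →
    Contract G (mstate Vs Es en)
      (mstate (Vs - proj₂ (en e)) (Es - e)
        (λ f → rename (proj₁ (en e)) (proj₂ (en e)) (proj₁ (en f))
             , rename (proj₁ (en e)) (proj₂ (en e)) (proj₂ (en f))))

IsTheta : {G : Graph} → ℕ → MState G → Set
IsTheta {G} r (mstate Vs Es en) =
  Σ (Fin (n G)) λ x → Σ (Fin (n G)) λ y → x ≢ y
  × (∀ v → (v ∈ Vs → (v ≡ x ⊎ v ≡ y)) × ((v ≡ x ⊎ v ≡ y) → v ∈ Vs))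
  × ∣ Es ∣ ≡ r
  × (∀ e → e ∈ Es → ((proj₁ (en e) ≡ x × proj₂ (en e) ≡ y) ⊎ (proj₁ (en e) ≡ y × proj₂ (en e) ≡ x)))

IsModel : (G : Graph) → ℕ → Subgraph G → Set
IsModel G r H = ∃ λ s → Star (Contract G) (mstate (VH H) (EH H) (ends G)) s × IsTheta r s

module Submission where

-- Let v be a vertex of maximum degree; as G is biconnected,
-- G - v is connected.  Grow a spanning tree of G - v and mark every
-- neighbour of v in it by one edge to v, so the tree carries deg(v) ≥ 2kr
-- marks.  Cutting the tree bottom-up splits it into edge-disjoint subtrees
-- with at least r marked vertices each; every subtree accounts for at most 2r
-- marks and fewer than r marks are left over, so there are at least k of
-- them.  A subtree together with r of its edges to v (a fan) is a model of
-- θ_r: contracting the tree edges one by one merges the subtree into a single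
-- vertex joined to v by r parallel edges.
module ThetaPacking where

  open import Defs
  open import Data.Nat using (ℕ; zero; suc; _+_; _*_; _⊔_; _≤_; _<_; _≤?_; z≤n; s≤s)
  open import Data.Nat.Properties
    using ( ≤-refl; ≤-reflexive; ≤-trans; ≤-antisym; <-irrefl; <⇒≤; ≰⇒>; <-≤-trans; ≤-<-trans; n≤1+n; m≤m+n
          ; +-comm; +-suc; +-identityʳ; +-mono-≤; +-monoˡ-≤; +-monoʳ-≤; +-monoʳ-<; *-monoʳ-≤; ⊔-sel; m≤n⇒m⊓n≡m
          ; module ≤-Reasoning )
  open import Data.Nat.Solver using (module +-*-Solver)
  open import Data.Fin using (Fin; zero; suc; _≟_; inject≤)
  open import Data.Fin.Properties using (any?; inject≤-injective)
  open import Data.Fin.Subset using (Subset; ∣_∣; ⊥; ⁅_⁆; inside; outside)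
    renaming (⊤ to ⊤ₛ; _∈_ to _∈ₛ_; _∉_ to _∉ₛ_; _-_ to _-ₛ_)
  open import Data.Fin.Subset.Properties
    using (nonempty?; ∈⊤; ∣⊤∣≡n; ∣⊥∣≡0; ⊆-antisym; p─⊥≡p; p⊆q⇒∣p∣≤∣q∣; p─q⊆p; x∈p∧x≢y⇒x∈p-y; x∈p⇒∣p-x∣<∣p∣)
  open import Data.Vec using (_∷_; tabulate) renaming (there to thereₛ)
  open import Data.Vec.Properties using (lookup∘tabulate; []=⇒lookup; lookup⇒[]=)
  open import Data.Bool using (true)
  open import Data.Unit using (⊤; tt)
  open import Data.Empty using (⊥-elim)
  import Data.Empty
  open import Data.Product using (Σ; ∃; _×_; _,_; proj₁; proj₂)
  import Data.Product
  open import Data.Sum using (_⊎_; inj₁; inj₂)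
  import Data.Sum
  open import Data.List using (List; []; _∷_; _++_; length; concat; map; lookup; take; foldr; allFin)
  open import Data.List.Properties using (length-take; length-++; length-map; map-++; concat-++; ++-identityʳ)
  open import Data.List.Membership.Propositional using (_∈_; _∉_)
  open import Data.List.Membership.Propositional.Properties using (∈-map⁺; ∈-++⁺ˡ; ∈-++⁺ʳ; ∈-++⁻; ∈-concat⁺′; ∈-lookup)
  import Data.List.Membership.DecPropositional as DecMembership
  open import Data.List.Relation.Unary.Any using (here; there)
  open import Data.List.Relation.Unary.All using (All; []; _∷_)
  import Data.List.Relation.Unary.All as All
  import Data.List.Relation.Unary.All.Properties as All
  open import Data.List.Relation.Unary.AllPairs using ([]; _∷_)
  open import Data.List.Relation.Unary.Unique.Propositional using (Unique)
  import Data.List.Relation.Unary.Unique.Propositional.Properties as Unique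
  open import Data.List.Relation.Binary.Permutation.Propositional
    using (_↭_; ↭⇒↭ₛ; ↭-refl; ↭-sym; ↭-trans; ↭-prep; module PermutationReasoning)
  open import Data.List.Relation.Binary.Permutation.Propositional.Properties
    using (++⁺ˡ; ++⁺ʳ; ++⁺; ++-comm; ++-commutativeMonoid; ∈-resp-↭; All-resp-↭; ↭-length)
  import Data.List.Relation.Binary.Permutation.Setoid.Properties as PermutationSetoid
  import Algebra.Solver.CommutativeMonoid as CommutativeMonoidSolver
  open import Function.Base using (_∘_)
  open import Function.Bundles using (_⇔_; mk⇔; Equivalence)
  open Equivalence using (to; from)
  open import Relation.Nullary using (¬_; ¬?; yes; no; does; Dec)
  open import Relation.Nullary.Decidable using (_×-dec_; _⊎-dec_)
  open import Relation.Binary.PropositionalEquality using (_≡_; _≢_; refl; sym; trans; cong; cong₂; subst; subst₂; setoid)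
  open import Relation.Binary.Construct.Closure.ReflexiveTransitive using (Star; ε; _◅_)

  -- Counting finite subsets by duplicate-free lists.  Degrees and edge
  -- numbers are cardinalities of subsets, while the construction works with
  -- lists; these lemmas translate between the two.

  x∉p-x : ∀ {N} (p : Subset N) (x : Fin N) → x ∉ₛ p -ₛ x
  x∉p-x (_ ∷ p) zero ()
  x∉p-x (_ ∷ p) (suc x) (thereₛ h) = x∉p-x p x h

  ∣p∣≤1+∣p-x∣ : ∀ {N} (p : Subset N) (x : Fin N) → ∣ p ∣ ≤ suc ∣ p -ₛ x ∣
  ∣p∣≤1+∣p-x∣ (inside  ∷ p) zero    = subst (λ q → suc ∣ p ∣ ≤ suc ∣ q ∣) (sym (p─⊥≡p p)) ≤-refl
  ∣p∣≤1+∣p-x∣ (outside ∷ p) zero    = subst (λ q → ∣ p ∣ ≤ suc ∣ q ∣) (sym (p─⊥≡p p)) (n≤1+n _)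
  ∣p∣≤1+∣p-x∣ (inside  ∷ p) (suc x) = s≤s (∣p∣≤1+∣p-x∣ p x)
  ∣p∣≤1+∣p-x∣ (outside ∷ p) (suc x) = ∣p∣≤1+∣p-x∣ p x

  ∈-∖⇔ : ∀ {N} (p : Subset N) b x → (x ∈ₛ p -ₛ b) ⇔ (x ∈ₛ p × x ≢ b)
  ∈-∖⇔ p b x = mk⇔ split (λ (x∈p , x≢b) → x∈p∧x≢y⇒x∈p-y x∈p x≢b)
    where
    split : x ∈ₛ p -ₛ b → x ∈ₛ p × x ≢ b
    split x∈p-b = p─q⊆p p ⁅ b ⁆ x∈p-b , x≢b
      where
      x≢b : x ≢ b
      x≢b refl = x∉p-x p x x∈p-b

  module _ {N : ℕ} where
    open DecMembership (_≟_ {N}) using (_∈?_)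

    ∣p∣≤length : (p : Subset N) (L : List (Fin N)) → (∀ {y} → y ∈ₛ p → y ∈ L) → ∣ p ∣ ≤ length L
    ∣p∣≤length p [] cover = subst (∣ p ∣ ≤_) (∣⊥∣≡0 N) (p⊆q⇒∣p∣≤∣q∣ {q = ⊥} λ y∈p → ⊥-elim (nothing-in-[] (cover y∈p)))
      where
      nothing-in-[] : ∀ {y : Fin N} → ¬ y ∈ []
      nothing-in-[] ()
    ∣p∣≤length p (x ∷ L) cover = ≤-trans (∣p∣≤1+∣p-x∣ p x) (s≤s (∣p∣≤length (p -ₛ x) L cover′))
      where
      cover′ : ∀ {y} → y ∈ₛ p -ₛ x → y ∈ L
      cover′ {y} y∈p-x with cover (p─q⊆p p _ y∈p-x)
      ... | here refl = ⊥-elim (x∉p-x p y y∈p-x)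
      ... | there y∈L = y∈L

    length≤∣p∣ : (p : Subset N) (L : List (Fin N)) → Unique L → (∀ {y} → y ∈ L → y ∈ₛ p) → length L ≤ ∣ p ∣
    length≤∣p∣ p []      _            _     = z≤n
    length≤∣p∣ p (x ∷ L) (x∉L ∷ uniq) inside-p =
      ≤-trans (s≤s (length≤∣p∣ (p -ₛ x) L uniq λ y∈L → x∈p∧x≢y⇒x∈p-y (inside-p (there y∈L)) (λ y≡x → All.lookup x∉L y∈L (sym y≡x))))
              (x∈p⇒∣p-x∣<∣p∣ (inside-p (here refl)))

    toSubset : List (Fin N) → Subset N
    toSubset L = tabulate λ x → does (x ∈? L)

    ∈toSubset⁻ : ∀ {x L} → x ∈ₛ toSubset L → x ∈ L
    ∈toSubset⁻ {x} {L} h with x ∈? L | trans (sym (lookup∘tabulate (λ y → does (y ∈? L)) x)) ([]=⇒lookup h)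
    ... | yes x∈L | _ = x∈L

    ∈toSubset⁺ : ∀ {x} L → x ∈ L → x ∈ₛ toSubset L
    ∈toSubset⁺ {x} L x∈L = lookup⇒[]= x _ (trans (lookup∘tabulate (λ y → does (y ∈? L)) x) (decided (x ∈? L)))
      where
      decided : (d : Dec (x ∈ L)) → does d ≡ true
      decided (yes _) = refl
      decided (no x∉L) = ⊥-elim (x∉L x∈L)

    ∣toSubset∣≡length : ∀ L → Unique L → ∣ toSubset L ∣ ≡ length L
    ∣toSubset∣≡length L uniq = ≤-antisym (∣p∣≤length (toSubset L) L ∈toSubset⁻) (length≤∣p∣ (toSubset L) L uniq (∈toSubset⁺ L))

  module _ {A : Set} where

    Unique-resp-↭ : ∀ {xs ys : List A} → xs ↭ ys → Unique xs → Unique ys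
    Unique-resp-↭ p = PermutationSetoid.Unique-resp-↭ (setoid A) (↭⇒↭ₛ p)

    ∈∉⇒≢ : ∀ {x y : A} {xs} → x ∈ xs → y ∉ xs → y ≢ x
    ∈∉⇒≢ x∈xs y∉xs refl = y∉xs x∈xs

    ∉-∷∷ : ∀ {a b y : A} {xs} → y ≢ a → y ≢ b → y ∉ xs → y ∉ a ∷ b ∷ xs
    ∉-∷∷ y≢a _   _    (here y≡a)          = y≢a y≡a
    ∉-∷∷ _   y≢b _    (there (here y≡b))  = y≢b y≡b
    ∉-∷∷ _   _   y∉xs (there (there y∈xs)) = y∉xs y∈xs

    Unique-++ˡ : ∀ (xs : List A) {ys} → Unique (xs ++ ys) → Unique xs
    Unique-++ˡ []       _            = []
    Unique-++ˡ (x ∷ xs) (x∉ ∷ uniq) = All.++⁻ˡ xs x∉ ∷ Unique-++ˡ xs uniq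

    Unique-++ʳ : ∀ (xs : List A) {ys} → Unique (xs ++ ys) → Unique ys
    Unique-++ʳ []       uniq        = uniq
    Unique-++ʳ (x ∷ xs) (_ ∷ uniq) = Unique-++ʳ xs uniq

    Unique-++-disjoint : ∀ (xs : List A) {ys z} → Unique (xs ++ ys) → z ∈ xs → z ∉ ys
    Unique-++-disjoint (x ∷ xs) (x∉ ∷ _)    (here refl) z∈ys = All.lookup x∉ (∈-++⁺ʳ xs z∈ys) refl
    Unique-++-disjoint (x ∷ xs) (_ ∷ uniq) (there z∈xs) z∈ys = Unique-++-disjoint xs uniq z∈xs z∈ys

    ∈-take : ∀ r (xs : List A) {z} → z ∈ take r xs → z ∈ xs
    ∈-take (suc r) (x ∷ xs) (here z≡x) = here z≡x
    ∈-take (suc r) (x ∷ xs) (there z∈) = there (∈-take r xs z∈)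

    Unique-concat-lookup : ∀ {B : Set} (f : B → List A) (xs : List B) → Unique (concat (map f xs)) →
                           ∀ i → Unique (f (lookup xs i))
    Unique-concat-lookup f (x ∷ xs) uniq zero    = Unique-++ˡ (f x) uniq
    Unique-concat-lookup f (x ∷ xs) uniq (suc i) = Unique-concat-lookup f xs (Unique-++ʳ (f x) uniq) i

    Unique-concat-disjoint : ∀ {B : Set} (f : B → List A) (xs : List B) → Unique (concat (map f xs)) →
                             ∀ {i j} → i ≢ j → ∀ {z} → z ∈ f (lookup xs i) → z ∉ f (lookup xs j)
    Unique-concat-disjoint f (x ∷ xs) uniq {zero}  {zero}  i≢j _ _ = i≢j refl
    Unique-concat-disjoint f (x ∷ xs) uniq {zero}  {suc j} _ z∈i z∈j =
      Unique-++-disjoint (f x) uniq z∈i (∈-concat⁺′ z∈j (∈-map⁺ f (∈-lookup {xs = xs} j)))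
    Unique-concat-disjoint f (x ∷ xs) uniq {suc i} {zero}  _ z∈i z∈j =
      Unique-++-disjoint (f x) uniq z∈j (∈-concat⁺′ z∈i (∈-map⁺ f (∈-lookup {xs = xs} i)))
    Unique-concat-disjoint f (x ∷ xs) uniq {suc i} {suc j} i≢j z∈i z∈j =
      Unique-concat-disjoint f xs (Unique-++ʳ (f x) uniq) (λ i≡j → i≢j (cong suc i≡j)) z∈i z∈j

  -- The vertex substitution performed by a sequence of contractions: every
  -- vertex of D becomes the representative c, all other vertices stay put.
  module _ {N : ℕ} where
    open DecMembership (_≟_ {N}) using (_∈?_)

    collapse : List (Fin N) → Fin N → Fin N → Fin N
    collapse D c x with x ∈? D
    ... | yes _ = c
    ... | no  _ = x

    collapse-∈ : ∀ D c {x} → x ∈ D → collapse D c x ≡ c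
    collapse-∈ D c {x} x∈D with x ∈? D
    ... | yes _   = refl
    ... | no  x∉D = ⊥-elim (x∉D x∈D)

    collapse-∉ : ∀ D c {x} → x ∉ D → collapse D c x ≡ x
    collapse-∉ D c {x} x∉D with x ∈? D
    ... | yes x∈D = ⊥-elim (x∉D x∈D)
    ... | no  _   = refl

    collapse-cases : ∀ D c x → (x ∈ D × collapse D c x ≡ c) ⊎ (x ∉ D × collapse D c x ≡ x)
    collapse-cases D c x with x ∈? D
    ... | yes x∈D = inj₁ (x∈D , refl)
    ... | no  x∉D = inj₂ (x∉D , refl)

    rename-cases : ∀ (a b x : Fin N) → (x ≡ b × rename a b x ≡ a) ⊎ (x ≢ b × rename a b x ≡ x)
    rename-cases a b x with x ≟ b
    ... | yes x≡b = inj₁ (x≡b , refl)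
    ... | no  x≢b = inj₂ (x≢b , refl)

    rename-hit : ∀ (a b : Fin N) → rename a b b ≡ a
    rename-hit a b with b ≟ b
    ... | yes _   = refl
    ... | no  b≢b = ⊥-elim (b≢b refl)

    rename-miss : ∀ (a b x : Fin N) → x ≢ b → rename a b x ≡ x
    rename-miss a b x x≢b with x ≟ b
    ... | yes x≡b = ⊥-elim (x≢b x≡b)
    ... | no  _   = refl

    collapse-absorb : ∀ D c {a b} y → a ∈ D → b ∈ D → collapse D c y ≡ collapse (a ∷ b ∷ D) c y
    collapse-absorb D c y a∈D b∈D with collapse-cases D c y
    ... | inj₁ (y∈D , y↦c) = trans y↦c (sym (collapse-∈ (_ ∷ _ ∷ D) c (there (there y∈D))))
    ... | inj₂ (y∉D , y↦y) =
      trans y↦y (sym (collapse-∉ (_ ∷ _ ∷ D) c (∉-∷∷ (∈∉⇒≢ a∈D y∉D) (∈∉⇒≢ b∈D y∉D) y∉D)))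

    -- Contracting an edge from a merged vertex a to a new vertex b: b joins the
    -- merged class, whose representative c is kept.
    collapse-extend : ∀ D c {a b} y → a ∈ D → b ∉ D → c ∈ D →
                      rename c b (collapse D c y) ≡ collapse (a ∷ b ∷ D) c y
    collapse-extend D c {a} {b} y a∈D b∉D c∈D with collapse-cases D c y
    ... | inj₁ (y∈D , y↦c) rewrite y↦c =
      trans (rename-miss c b c (∈∉⇒≢ c∈D b∉D ∘ sym)) (sym (collapse-∈ (a ∷ b ∷ D) c (there (there y∈D))))
    ... | inj₂ (y∉D , y↦y) rewrite y↦y with rename-cases c b y
    ...   | inj₁ (refl , y↦c) = trans y↦c (sym (collapse-∈ (a ∷ y ∷ D) c (there (here refl))))
    ...   | inj₂ (y≢b  , y↦y′) = trans y↦y′ (sym (collapse-∉ (a ∷ b ∷ D) c (∉-∷∷ (∈∉⇒≢ a∈D y∉D) y≢b y∉D)))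

    -- Contracting an edge from a new vertex a to a merged vertex b: the merged
    -- class is absorbed into a, which becomes the new representative.
    collapse-reroot : ∀ D c {a b} y → a ∉ D → b ∈ D → c ∈ D →
                      rename a c (collapse D c y) ≡ collapse (a ∷ b ∷ D) a y
    collapse-reroot D c {a} {b} y a∉D b∈D c∈D with collapse-cases D c y
    ... | inj₁ (y∈D , y↦c) rewrite y↦c =
      trans (rename-hit a c) (sym (collapse-∈ (a ∷ b ∷ D) a (there (there y∈D))))
    ... | inj₂ (y∉D , y↦y) rewrite y↦y | rename-miss a c y (∈∉⇒≢ c∈D y∉D) with collapse-cases (a ∷ b ∷ D) a y
    ...   | inj₁ (here y≡a , y↦a)          = trans y≡a (sym y↦a)
    ...   | inj₁ (there (here y≡b) , _)    = ⊥-elim (y∉D (subst (_∈ D) (sym y≡b) b∈D))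
    ...   | inj₁ (there (there y∈D) , _)   = ⊥-elim (y∉D y∈D)
    ...   | inj₂ (_ , y↦y′)                = sym y↦y′

  cong₃ : ∀ {A B C D : Set} (f : A → B → C → D) {a a′ b b′ c c′} →
          a ≡ a′ → b ≡ b′ → c ≡ c′ → f a b c ≡ f a′ b′ c′
  cong₃ f refl refl refl = refl

  -- Fans around a vertex v.  A fan rooted at w consists of a list F of edges
  -- of G - v grown from w (each edge meets a vertex reached before it), and a
  -- list T of spokes, edges joining v to vertices reached by F.  Contracting F
  -- in order collapses everything but v to one vertex, turning the fan into
  -- θ_|T| (fan-model).
  module Fans (G : Graph) (v : Fin (n G)) where

    V : Set
    V = Fin (n G)

    E : Set
    E = Fin (m G)

    e₁ e₂ : E → V
    e₁ e = proj₁ (ends G e)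
    e₂ e = proj₂ (ends G e)

    Avoid : E → Set
    Avoid e = e₁ e ≢ v × e₂ e ≢ v

    Touch : E → Set
    Touch t = e₁ t ≡ v ⊎ e₂ t ≡ v

    Touch⇒≢Avoid : ∀ {t f} → Touch t → Avoid f → t ≢ f
    Touch⇒≢Avoid (inj₁ t₁≡v) (f₁≢v , _) refl = f₁≢v t₁≡v
    Touch⇒≢Avoid (inj₂ t₂≡v) (_ , f₂≢v) refl = f₂≢v t₂≡v

    Joins⇒Touch : ∀ {t u} → Joins G t v u → Touch t
    Joins⇒Touch (inj₁ (t₁≡v , _)) = inj₁ t₁≡v
    Joins⇒Touch (inj₂ (_ , t₂≡v)) = inj₂ t₂≡v

    ends-from : ∀ {e w x} (P : V → Set) → Joins G e w x → P w → P x → P (e₁ e) × P (e₂ e)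
    ends-from P (inj₁ (e₁≡w , e₂≡x)) pw px = subst P (sym e₁≡w) pw , subst P (sym e₂≡x) px
    ends-from P (inj₂ (e₁≡x , e₂≡w)) pw px = subst P (sym e₁≡x) px , subst P (sym e₂≡w) pw

    end-to : ∀ {e w x} (P : V → Set) → Joins G e w x → P (e₁ e) → P (e₂ e) → P x
    end-to P (inj₁ (_ , e₂≡x)) _ p₂ = subst P e₂≡x p₂
    end-to P (inj₂ (e₁≡x , _)) p₁ _ = subst P e₁≡x p₁

    endpoints : List E → List V
    endpoints []      = []
    endpoints (e ∷ F) = e₁ e ∷ e₂ e ∷ endpoints F

    ∈-endpoints₁ : ∀ {e} F → e ∈ F → e₁ e ∈ endpoints F
    ∈-endpoints₁ (_ ∷ F) (here refl) = here refl
    ∈-endpoints₁ (_ ∷ F) (there e∈F) = there (there (∈-endpoints₁ F e∈F))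

    ∈-endpoints₂ : ∀ {e} F → e ∈ F → e₂ e ∈ endpoints F
    ∈-endpoints₂ (_ ∷ F) (here refl) = there (here refl)
    ∈-endpoints₂ (_ ∷ F) (there e∈F) = there (there (∈-endpoints₂ F e∈F))

    reached : List V → List E → List V
    reached D []      = D
    reached D (e ∷ F) = reached (e₁ e ∷ e₂ e ∷ D) F

    reached-++ : ∀ D F₁ F₂ → reached D (F₁ ++ F₂) ≡ reached (reached D F₁) F₂
    reached-++ D []       F₂ = refl
    reached-++ D (e ∷ F₁) F₂ = reached-++ _ F₁ F₂

    reached⁻ : ∀ D F {x} → x ∈ reached D F → x ∈ D ⊎ x ∈ endpoints F
    reached⁻ D [] x∈ = inj₁ x∈
    reached⁻ D (e ∷ F) x∈ with reached⁻ (e₁ e ∷ e₂ e ∷ D) F x∈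
    ... | inj₁ (here x≡e₁)         = inj₂ (here x≡e₁)
    ... | inj₁ (there (here x≡e₂)) = inj₂ (there (here x≡e₂))
    ... | inj₁ (there (there x∈D)) = inj₁ x∈D
    ... | inj₂ x∈F                 = inj₂ (there (there x∈F))

    reached⁺ˡ : ∀ D F {x} → x ∈ D → x ∈ reached D F
    reached⁺ˡ D []      x∈D = x∈D
    reached⁺ˡ D (e ∷ F) x∈D = reached⁺ˡ _ F (there (there x∈D))

    reached⁺ʳ : ∀ D F {x} → x ∈ endpoints F → x ∈ reached D F
    reached⁺ʳ D (e ∷ F) (here x≡e₁)         = reached⁺ˡ _ F (here x≡e₁)
    reached⁺ʳ D (e ∷ F) (there (here x≡e₂)) = reached⁺ˡ _ F (there (here x≡e₂))
    reached⁺ʳ D (e ∷ F) (there (there x∈F)) = reached⁺ʳ _ F x∈F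

    reached-mono : ∀ D D′ F → (∀ {y} → y ∈ D → y ∈ D′) → ∀ {y} → y ∈ reached D F → y ∈ reached D′ F
    reached-mono D D′ F D⊆D′ y∈ with reached⁻ D F y∈
    ... | inj₁ y∈D = reached⁺ˡ D′ F (D⊆D′ y∈D)
    ... | inj₂ y∈F = reached⁺ʳ D′ F y∈F

    Grows : List V → List E → Set
    Grows D []      = ⊤
    Grows D (e ∷ F) = (e₁ e ∈ D ⊎ e₂ e ∈ D) × Grows (e₁ e ∷ e₂ e ∷ D) F

    Grows-++ : ∀ D F₁ F₂ → Grows D F₁ → Grows (reached D F₁) F₂ → Grows D (F₁ ++ F₂)
    Grows-++ D []       F₂ _              grows₂ = grows₂
    Grows-++ D (e ∷ F₁) F₂ (meets , grows₁) grows₂ = meets , Grows-++ _ F₁ F₂ grows₁ grows₂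

    Grows-mono : ∀ D D′ F → (∀ {y} → y ∈ D → y ∈ D′) → Grows D F → Grows D′ F
    Grows-mono D D′ []      D⊆D′ _ = tt
    Grows-mono D D′ (e ∷ F) D⊆D′ (meets , grows) =
      Data.Sum.map D⊆D′ D⊆D′ meets , Grows-mono _ _ F extend grows
      where
      extend : ∀ {y} → y ∈ e₁ e ∷ e₂ e ∷ D → y ∈ e₁ e ∷ e₂ e ∷ D′
      extend (here y≡e₁)         = here y≡e₁
      extend (there (here y≡e₂)) = there (here y≡e₂)
      extend (there (there y∈D)) = there (there (D⊆D′ y∈D))

    Spoke : List V → E → Set
    Spoke D t = Σ V λ u → u ∈ D × Joins G t v u

    spokes-touch : ∀ {D T} → All (Spoke D) T → All Touch T
    spokes-touch = All.map λ (_ , _ , joins) → Joins⇒Touch joins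

    Spoke-mono : ∀ {D D′} → (∀ {y} → y ∈ D → y ∈ D′) → ∀ {t} → Spoke D t → Spoke D′ t
    Spoke-mono D⊆D′ (u , u∈D , joins) = u , D⊆D′ u∈D , joins

    record Fan (w : V) (T F : List E) : Set where
      field
        grows  : Grows (w ∷ []) F
        avoids : All Avoid F
        spokes : All (Spoke (reached (w ∷ []) F)) T

    fan-join : ∀ {w x e aT aF bT bF} → Joins G e w x → Avoid e →
               Fan w aT aF → Fan x bT bF → Fan w (aT ++ bT) (aF ++ e ∷ bF)
    fan-join {w} {x} {e} {aT} {aF} {bT} {bF} joins avoid fa fb = record
      { grows  = Grows-++ _ aF (e ∷ bF) (Fan.grows fa) (e-meets joins , Grows-mono _ _ bF x-reached (Fan.grows fb))
      ; avoids = All.++⁺ (Fan.avoids fa) (avoid ∷ Fan.avoids fb)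
      ; spokes = All.++⁺ (All.map (Spoke-mono from-a) (Fan.spokes fa)) (All.map (Spoke-mono from-b) (Fan.spokes fb))
      }
      where
      Ra : List V
      Ra = reached (w ∷ []) aF
      w∈Ra : w ∈ Ra
      w∈Ra = reached⁺ˡ _ aF (here refl)
      e-meets : Joins G e w x → e₁ e ∈ Ra ⊎ e₂ e ∈ Ra
      e-meets (inj₁ (e₁≡w , _)) = inj₁ (subst (_∈ Ra) (sym e₁≡w) w∈Ra)
      e-meets (inj₂ (_ , e₂≡w)) = inj₂ (subst (_∈ Ra) (sym e₂≡w) w∈Ra)
      x-reached : ∀ {y} → y ∈ x ∷ [] → y ∈ e₁ e ∷ e₂ e ∷ Ra
      x-reached (here refl) = end-to (_∈ e₁ e ∷ e₂ e ∷ Ra) joins (here refl) (there (here refl))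
      from-a : ∀ {y} → y ∈ Ra → y ∈ reached (w ∷ []) (aF ++ e ∷ bF)
      from-a y∈ rewrite reached-++ (w ∷ []) aF (e ∷ bF) = reached⁺ˡ _ bF (there (there y∈))
      from-b : ∀ {y} → y ∈ reached (x ∷ []) bF → y ∈ reached (w ∷ []) (aF ++ e ∷ bF)
      from-b y∈ rewrite reached-++ (w ∷ []) aF (e ∷ bF) = reached-mono _ _ bF x-reached y∈

    -- Vertices still present while contracting: v, the representative c of
    -- the merged set D, and the not yet merged endpoints of the edges R left.
    Remaining : List V → V → List E → V → Set
    Remaining D c R x = x ≡ v ⊎ x ≡ c ⊎ (x ∈ endpoints R × x ∉ D)

    -- The contraction invariant: all vertices of D are merged into c ∈ D and
    -- the edges left are the spokes T and the unprocessed tree edges R.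
    record Collapsed (T : List E) (D : List V) (R : List E) (s : MState G) : Set where
      field
        rep      : V
        rep∈D    : rep ∈ D
        D∌v      : ∀ {x} → x ∈ D → x ≢ v
        end₁     : ∀ f → proj₁ (MState.en s f) ≡ collapse D rep (e₁ f)
        end₂     : ∀ f → proj₂ (MState.en s f) ≡ collapse D rep (e₂ f)
        vertices : ∀ x → (x ∈ₛ MState.Vs s) ⇔ Remaining D rep R x
        edges    : ∀ f → (f ∈ₛ MState.Es s) ⇔ (f ∈ T ⊎ f ∈ R)

    edges-step : ∀ {T} → All Touch T → ∀ (Es : Subset (m G)) {e R} → Avoid e → e ∉ R →
                 (∀ f → (f ∈ₛ Es) ⇔ (f ∈ T ⊎ f ∈ e ∷ R)) →
                 ∀ f → (f ∈ₛ Es -ₛ e) ⇔ (f ∈ T ⊎ f ∈ R)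
    edges-step {T} touch Es {e} {R} avoid e∉R edges f = mk⇔ forth back
      where
      forth : f ∈ₛ Es -ₛ e → f ∈ T ⊎ f ∈ R
      forth f∈ with to (∈-∖⇔ Es e f) f∈
      ... | f∈Es , f≢e with to (edges f) f∈Es
      ...   | inj₁ f∈T         = inj₁ f∈T
      ...   | inj₂ (here f≡e)  = ⊥-elim (f≢e f≡e)
      ...   | inj₂ (there f∈R) = inj₂ f∈R
      back : f ∈ T ⊎ f ∈ R → f ∈ₛ Es -ₛ e
      back (inj₁ f∈T) = from (∈-∖⇔ Es e f) (from (edges f) (inj₁ f∈T) , Touch⇒≢Avoid (All.lookup touch f∈T) avoid)
      back (inj₂ f∈R) = from (∈-∖⇔ Es e f) (from (edges f) (inj₂ (there f∈R)) , λ { refl → e∉R f∈R })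

    remaining-absorb : ∀ (Vs : Subset (n G)) D c {e R} → e₁ e ∈ D → e₂ e ∈ D →
                       (∀ x → (x ∈ₛ Vs) ⇔ Remaining D c (e ∷ R) x) →
                       ∀ x → (x ∈ₛ Vs) ⇔ Remaining (e₁ e ∷ e₂ e ∷ D) c R x
    remaining-absorb Vs D c {e} {R} a∈D b∈D old x = mk⇔ (forth ∘ to (old x)) (from (old x) ∘ back)
      where
      forth : Remaining D c (e ∷ R) x → Remaining (e₁ e ∷ e₂ e ∷ D) c R x
      forth (inj₁ x≡v)                                = inj₁ x≡v
      forth (inj₂ (inj₁ x≡c))                         = inj₂ (inj₁ x≡c)
      forth (inj₂ (inj₂ (here refl , x∉D)))           = ⊥-elim (x∉D a∈D)
      forth (inj₂ (inj₂ (there (here refl) , x∉D)))   = ⊥-elim (x∉D b∈D)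
      forth (inj₂ (inj₂ (there (there x∈R) , x∉D)))   =
        inj₂ (inj₂ (x∈R , ∉-∷∷ (λ { refl → x∉D a∈D }) (λ { refl → x∉D b∈D }) x∉D))
      back : Remaining (e₁ e ∷ e₂ e ∷ D) c R x → Remaining D c (e ∷ R) x
      back (inj₁ x≡v)                = inj₁ x≡v
      back (inj₂ (inj₁ x≡c))         = inj₂ (inj₁ x≡c)
      back (inj₂ (inj₂ (x∈R , x∉D′))) = inj₂ (inj₂ (there (there x∈R) , x∉D′ ∘ there ∘ there))

    remaining-extend : ∀ (Vs : Subset (n G)) D c {e R} → e₁ e ∈ D → e₂ e ∉ D → c ∈ D → Avoid e →
                       (∀ x → (x ∈ₛ Vs) ⇔ Remaining D c (e ∷ R) x) →
                       ∀ x → (x ∈ₛ Vs -ₛ e₂ e) ⇔ Remaining (e₁ e ∷ e₂ e ∷ D) c R x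
    remaining-extend Vs D c {e} {R} a∈D b∉D c∈D avoid old x =
      mk⇔ (forth ∘ to (∈-∖⇔ Vs (e₂ e) x)) (from (∈-∖⇔ Vs (e₂ e) x) ∘ back)
      where
      forth : x ∈ₛ Vs × x ≢ e₂ e → Remaining (e₁ e ∷ e₂ e ∷ D) c R x
      forth (x∈Vs , x≢b) with to (old x) x∈Vs
      ... | inj₁ x≡v                              = inj₁ x≡v
      ... | inj₂ (inj₁ x≡c)                       = inj₂ (inj₁ x≡c)
      ... | inj₂ (inj₂ (here refl , x∉D))         = ⊥-elim (x∉D a∈D)
      ... | inj₂ (inj₂ (there (here refl) , _))   = ⊥-elim (x≢b refl)
      ... | inj₂ (inj₂ (there (there x∈R) , x∉D)) = inj₂ (inj₂ (x∈R , ∉-∷∷ (λ { refl → x∉D a∈D }) x≢b x∉D))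
      back : Remaining (e₁ e ∷ e₂ e ∷ D) c R x → x ∈ₛ Vs × x ≢ e₂ e
      back (inj₁ refl)                = from (old x) (inj₁ refl) , proj₂ avoid ∘ sym
      back (inj₂ (inj₁ refl))         = from (old x) (inj₂ (inj₁ refl)) , ∈∉⇒≢ c∈D b∉D ∘ sym
      back (inj₂ (inj₂ (x∈R , x∉D′))) =
        from (old x) (inj₂ (inj₂ (there (there x∈R) , x∉D′ ∘ there ∘ there))) , λ { refl → x∉D′ (there (here refl)) }

    remaining-reroot : ∀ (Vs : Subset (n G)) D c {e R} → e₁ e ∉ D → e₂ e ∈ D → c ∈ D →
                       (∀ {x} → x ∈ D → x ≢ v) →
                       (∀ x → (x ∈ₛ Vs) ⇔ Remaining D c (e ∷ R) x) →
                       ∀ x → (x ∈ₛ Vs -ₛ c) ⇔ Remaining (e₁ e ∷ e₂ e ∷ D) (e₁ e) R x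
    remaining-reroot Vs D c {e} {R} a∉D b∈D c∈D D∌v old x =
      mk⇔ (forth ∘ to (∈-∖⇔ Vs c x)) (from (∈-∖⇔ Vs c x) ∘ back)
      where
      forth : x ∈ₛ Vs × x ≢ c → Remaining (e₁ e ∷ e₂ e ∷ D) (e₁ e) R x
      forth (x∈Vs , x≢c) with to (old x) x∈Vs
      ... | inj₁ x≡v                              = inj₁ x≡v
      ... | inj₂ (inj₁ x≡c)                       = ⊥-elim (x≢c x≡c)
      ... | inj₂ (inj₂ (here refl , _))           = inj₂ (inj₁ refl)
      ... | inj₂ (inj₂ (there (here refl) , x∉D)) = ⊥-elim (x∉D b∈D)
      ... | inj₂ (inj₂ (there (there x∈R) , x∉D)) with x ≟ e₁ e
      ...   | yes x≡a = inj₂ (inj₁ x≡a)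
      ...   | no  x≢a = inj₂ (inj₂ (x∈R , ∉-∷∷ x≢a (λ { refl → x∉D b∈D }) x∉D))
      back : Remaining (e₁ e ∷ e₂ e ∷ D) (e₁ e) R x → x ∈ₛ Vs × x ≢ c
      back (inj₁ refl)                = from (old x) (inj₁ refl) , D∌v c∈D ∘ sym
      back (inj₂ (inj₁ refl))         = from (old x) (inj₂ (inj₂ (here refl , a∉D))) , λ { refl → a∉D c∈D }
      back (inj₂ (inj₂ (x∈R , x∉D′))) =
        from (old x) (inj₂ (inj₂ (there (there x∈R) , x∉D′ ∘ there ∘ there))) , λ { refl → x∉D′ (there (there c∈D)) }

    StepTo : List E → List V → List E → MState G → Set
    StepTo T D R s = Σ (MState G) λ s′ → Contract G s s′ × Collapsed T D R s′

    D∌v-extend : ∀ {D e} → Avoid e → (∀ {x} → x ∈ D → x ≢ v) → ∀ {x} → x ∈ e₁ e ∷ e₂ e ∷ D → x ≢ v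
    D∌v-extend (e₁≢v , _) _   (here refl)         = e₁≢v
    D∌v-extend (_ , e₂≢v) _   (there (here refl)) = e₂≢v
    D∌v-extend _          D∌v (there (there x∈D)) = D∌v x∈D

    -- Both ends of e are already merged: e is now a loop and is deleted.
    step-loop : ∀ {T D e R Vs Es en} → All Touch T → Avoid e → e ∉ R → e₁ e ∈ D → e₂ e ∈ D →
                Collapsed T D (e ∷ R) (mstate Vs Es en) → StepTo T (e₁ e ∷ e₂ e ∷ D) R (mstate Vs Es en)
    step-loop {D = D} {e} {Vs = Vs} {Es} {en} touch avoid e∉R a∈D b∈D inv =
      mstate Vs (Es -ₛ e) en , contractLoop e e∈Es is-loop , record
        { rep      = rep
        ; rep∈D    = there (there rep∈D)
        ; D∌v      = D∌v-extend avoid D∌v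
        ; end₁     = λ f → trans (end₁ f) (collapse-absorb D rep (e₁ f) a∈D b∈D)
        ; end₂     = λ f → trans (end₂ f) (collapse-absorb D rep (e₂ f) a∈D b∈D)
        ; vertices = remaining-absorb Vs D rep a∈D b∈D vertices
        ; edges    = edges-step touch Es avoid e∉R edges
        }
      where
      open Collapsed inv
      e∈Es : e ∈ₛ Es
      e∈Es = from (edges e) (inj₂ (here refl))
      is-loop : proj₁ (en e) ≡ proj₂ (en e)
      is-loop = trans (end₁ e) (trans (collapse-∈ D rep a∈D) (sym (trans (end₂ e) (collapse-∈ D rep b∈D))))

    step-extend : ∀ {T D e R Vs Es en} → All Touch T → Avoid e → e ∉ R → e₁ e ∈ D → e₂ e ∉ D →
                  Collapsed T D (e ∷ R) (mstate Vs Es en) → StepTo T (e₁ e ∷ e₂ e ∷ D) R (mstate Vs Es en)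
    step-extend {D = D} {e} {R} {Vs} {Es} {en} touch avoid e∉R a∈D b∉D inv =
      _ , contractEdge e e∈Es proper , record
        { rep      = rep
        ; rep∈D    = there (there rep∈D)
        ; D∌v      = D∌v-extend avoid D∌v
        ; end₁     = λ f → trans (cong₃ rename ends₁ ends₂ (end₁ f)) (collapse-extend D rep (e₁ f) a∈D b∉D rep∈D)
        ; end₂     = λ f → trans (cong₃ rename ends₁ ends₂ (end₂ f)) (collapse-extend D rep (e₂ f) a∈D b∉D rep∈D)
        ; vertices = subst (λ z → ∀ x → (x ∈ₛ Vs -ₛ z) ⇔ Remaining (e₁ e ∷ e₂ e ∷ D) rep R x) (sym ends₂)
                           (remaining-extend Vs D rep a∈D b∉D rep∈D avoid vertices)
        ; edges    = edges-step touch Es avoid e∉R edges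
        }
      where
      open Collapsed inv
      e∈Es : e ∈ₛ Es
      e∈Es = from (edges e) (inj₂ (here refl))
      ends₁ : proj₁ (en e) ≡ rep
      ends₁ = trans (end₁ e) (collapse-∈ D rep a∈D)
      ends₂ : proj₂ (en e) ≡ e₂ e
      ends₂ = trans (end₂ e) (collapse-∉ D rep b∉D)
      proper : proj₁ (en e) ≢ proj₂ (en e)
      proper q = ∈∉⇒≢ rep∈D b∉D (sym (trans (sym ends₁) (trans q ends₂)))

    step-reroot : ∀ {T D e R Vs Es en} → All Touch T → Avoid e → e ∉ R → e₁ e ∉ D → e₂ e ∈ D →
                  Collapsed T D (e ∷ R) (mstate Vs Es en) → StepTo T (e₁ e ∷ e₂ e ∷ D) R (mstate Vs Es en)
    step-reroot {D = D} {e} {R} {Vs} {Es} {en} touch avoid e∉R a∉D b∈D inv =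
      _ , contractEdge e e∈Es proper , record
        { rep      = e₁ e
        ; rep∈D    = here refl
        ; D∌v      = D∌v-extend avoid D∌v
        ; end₁     = λ f → trans (cong₃ rename ends₁ ends₂ (end₁ f)) (collapse-reroot D rep (e₁ f) a∉D b∈D rep∈D)
        ; end₂     = λ f → trans (cong₃ rename ends₁ ends₂ (end₂ f)) (collapse-reroot D rep (e₂ f) a∉D b∈D rep∈D)
        ; vertices = subst (λ z → ∀ x → (x ∈ₛ Vs -ₛ z) ⇔ Remaining (e₁ e ∷ e₂ e ∷ D) (e₁ e) R x) (sym ends₂)
                           (remaining-reroot Vs D rep a∉D b∈D rep∈D D∌v vertices)
        ; edges    = edges-step touch Es avoid e∉R edges
        }
      where
      open Collapsed inv
      e∈Es : e ∈ₛ Es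
      e∈Es = from (edges e) (inj₂ (here refl))
      ends₁ : proj₁ (en e) ≡ e₁ e
      ends₁ = trans (end₁ e) (collapse-∉ D rep a∉D)
      ends₂ : proj₂ (en e) ≡ rep
      ends₂ = trans (end₂ e) (collapse-∈ D rep b∈D)
      proper : proj₁ (en e) ≢ proj₂ (en e)
      proper q = ∈∉⇒≢ rep∈D a∉D (trans (sym ends₁) (trans q ends₂))

    open DecMembership (_≟_ {n G}) using (_∈?_)

    contract-step : ∀ {T D e R Vs Es en} → All Touch T → Avoid e → e ∉ R → (e₁ e ∈ D ⊎ e₂ e ∈ D) →
                    Collapsed T D (e ∷ R) (mstate Vs Es en) → StepTo T (e₁ e ∷ e₂ e ∷ D) R (mstate Vs Es en)
    contract-step {D = D} {e} touch avoid e∉R meets with e₁ e ∈? D | e₂ e ∈? D | meets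
    ... | yes a∈D | yes b∈D | _        = step-loop   touch avoid e∉R a∈D b∈D
    ... | yes a∈D | no  b∉D | _        = step-extend touch avoid e∉R a∈D b∉D
    ... | no  a∉D | yes b∈D | _        = step-reroot touch avoid e∉R a∉D b∈D
    ... | no  a∉D | no  _   | inj₁ a∈D = ⊥-elim (a∉D a∈D)
    ... | no  _   | no  b∉D | inj₂ b∈D = ⊥-elim (b∉D b∈D)

    contract-tree : ∀ {T} → All Touch T → ∀ R D s → Collapsed T D R s → Grows D R → All Avoid R → Unique R →
                    Σ (MState G) λ s′ → Star (Contract G) s s′ × Collapsed T (reached D R) [] s′
    contract-tree touch []      D s                  inv _                _                 _ = s , ε , inv
    contract-tree touch (e ∷ R) D (mstate Vs Es en) inv (meets , grows) (avoid ∷ avoids) (e∉R ∷ uniq)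
      with contract-step touch avoid (λ e∈R → All.lookup e∉R e∈R refl) meets inv
    ... | s′ , first , inv′ with contract-tree touch R _ s′ inv′ grows avoids uniq
    ...   | s″ , rest , inv″ = s″ , first ◅ rest , inv″

    fanSubgraph : ∀ {w T F} → Fan w T F → Subgraph G
    fanSubgraph {w} {T} {F} fan = record
      { VH = toSubset (v ∷ reached (w ∷ []) F) ; EH = toSubset (T ++ F) ; closed = ends-closed }
      where
      Vfan : List V
      Vfan = v ∷ reached (w ∷ []) F
      ends-in : ∀ {e} → e ∈ T ⊎ e ∈ F → e₁ e ∈ Vfan × e₂ e ∈ Vfan
      ends-in (inj₁ e∈T) with All.lookup (Fan.spokes fan) e∈T
      ... | u , u∈R , inj₁ (e₁≡v , e₂≡u) = here e₁≡v , there (subst (_∈ _) (sym e₂≡u) u∈R)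
      ... | u , u∈R , inj₂ (e₁≡u , e₂≡v) = there (subst (_∈ _) (sym e₁≡u) u∈R) , here e₂≡v
      ends-in (inj₂ e∈F) = there (reached⁺ʳ _ F (∈-endpoints₁ F e∈F)) , there (reached⁺ʳ _ F (∈-endpoints₂ F e∈F))
      ends-closed : ∀ e → e ∈ₛ toSubset (T ++ F) → e₁ e ∈ₛ toSubset Vfan × e₂ e ∈ₛ toSubset Vfan
      ends-closed e e∈ = Data.Product.map (∈toSubset⁺ Vfan) (∈toSubset⁺ Vfan) (ends-in (∈-++⁻ T (∈toSubset⁻ e∈)))

    fan-start : ∀ {w T F} → w ≢ v → (fan : Fan w T F) →
                Collapsed T (w ∷ []) F (mstate (VH (fanSubgraph fan)) (EH (fanSubgraph fan)) (ends G))
    fan-start {w} {T} {F} w≢v fan = record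
      { rep      = w
      ; rep∈D    = here refl
      ; D∌v      = λ { (here refl) → w≢v }
      ; end₁     = λ f → sym (collapse-single (e₁ f))
      ; end₂     = λ f → sym (collapse-single (e₂ f))
      ; vertices = λ x → mk⇔ (forth x ∘ ∈toSubset⁻) (∈toSubset⁺ (v ∷ Rw) ∘ back x)
      ; edges    = λ f → mk⇔ (∈-++⁻ T ∘ ∈toSubset⁻) (∈toSubset⁺ (T ++ F) ∘ Data.Sum.[ ∈-++⁺ˡ , ∈-++⁺ʳ T ])
      }
      where
      Rw : List V
      Rw = reached (w ∷ []) F
      collapse-single : ∀ y → collapse (w ∷ []) w y ≡ y
      collapse-single y with collapse-cases (w ∷ []) w y
      ... | inj₁ (here y≡w , y↦w) = trans y↦w (sym y≡w)
      ... | inj₂ (_ , y↦y)        = y↦y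
      forth : ∀ x → x ∈ v ∷ Rw → Remaining (w ∷ []) w F x
      forth x (here x≡v) = inj₁ x≡v
      forth x (there x∈Rw) with reached⁻ (w ∷ []) F x∈Rw | x ≟ w
      ... | _              | yes x≡w = inj₂ (inj₁ x≡w)
      ... | inj₁ (here x≡w) | no x≢w = ⊥-elim (x≢w x≡w)
      ... | inj₂ x∈F        | no x≢w = inj₂ (inj₂ (x∈F , λ { (here x≡w) → x≢w x≡w }))
      back : ∀ x → Remaining (w ∷ []) w F x → x ∈ v ∷ Rw
      back x (inj₁ x≡v)              = here x≡v
      back x (inj₂ (inj₁ refl))      = there (reached⁺ˡ (w ∷ []) F (here refl))
      back x (inj₂ (inj₂ (x∈F , _))) = there (reached⁺ʳ (w ∷ []) F x∈F)

    -- Once all tree edges are contracted, only v, the representative and the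
    -- spokes between them are left: the state is θ_|T|.
    collapsed-theta : ∀ {T D s} → Collapsed T D [] s → All (Spoke D) T → Unique T → IsTheta (length T) s
    collapsed-theta {T} {D} {s} inv spokes uniq = v , rep , D∌v rep∈D ∘ sym , two-vertices , card , edges-between
      where
      open Collapsed inv
      two-vertices : ∀ x → (x ∈ₛ MState.Vs s → x ≡ v ⊎ x ≡ rep) × (x ≡ v ⊎ x ≡ rep → x ∈ₛ MState.Vs s)
      two-vertices x = only ∘ to (vertices x) , from (vertices x) ∘ Data.Sum.map₂ inj₁
        where
        only : Remaining D rep [] x → x ≡ v ⊎ x ≡ rep
        only (inj₁ x≡v)         = inj₁ x≡v
        only (inj₂ (inj₁ x≡c))  = inj₂ x≡c
        only (inj₂ (inj₂ (() , _)))
      only-spokes : ∀ {f} → f ∈ T ⊎ f ∈ [] → f ∈ T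
      only-spokes (inj₁ f∈T) = f∈T
      card : ∣ MState.Es s ∣ ≡ length T
      card = trans (cong ∣_∣ (⊆-antisym (λ f∈Es → ∈toSubset⁺ T (only-spokes (to (edges _) f∈Es)))
                                        (λ f∈T → from (edges _) (inj₁ (∈toSubset⁻ f∈T)))))
                   (∣toSubset∣≡length T uniq)
      v↦v : collapse D rep v ≡ v
      v↦v = collapse-∉ D rep (λ v∈D → D∌v v∈D refl)
      edges-between : ∀ e → e ∈ₛ MState.Es s →
        (proj₁ (MState.en s e) ≡ v × proj₂ (MState.en s e) ≡ rep) ⊎ (proj₁ (MState.en s e) ≡ rep × proj₂ (MState.en s e) ≡ v)
      edges-between e e∈Es with All.lookup spokes (only-spokes (to (edges e) e∈Es))
      ... | u , u∈D , inj₁ (e₁≡v , e₂≡u) =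
        inj₁ ( trans (end₁ e) (trans (cong (collapse D rep) e₁≡v) v↦v)
             , trans (end₂ e) (trans (cong (collapse D rep) e₂≡u) (collapse-∈ D rep u∈D)))
      ... | u , u∈D , inj₂ (e₁≡u , e₂≡v) =
        inj₂ ( trans (end₁ e) (trans (cong (collapse D rep) e₁≡u) (collapse-∈ D rep u∈D))
             , trans (end₂ e) (trans (cong (collapse D rep) e₂≡v) v↦v))

    fan-model : ∀ {w T F} → w ≢ v → (fan : Fan w T F) → Unique T → Unique F → IsModel G (length T) (fanSubgraph fan)
    fan-model {w} {T} {F} w≢v fan uniqT uniqF
      with contract-tree (spokes-touch (Fan.spokes fan)) F (w ∷ []) _ (fan-start w≢v fan) (Fan.grows fan) (Fan.avoids fan) uniqF
    ... | s , steps , inv = s , steps , collapsed-theta inv (Fan.spokes fan) uniqT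

  -- Arithmetic of the piece count in the cutting procedure: D = 2r bounds the
  -- number of marks of two merged remainders, each of which has fewer than r.
  module Counting where
    open +-*-Solver
    open ≤-Reasoning

    -- Closing the merged remainder a + b as a new piece.
    count-close : ∀ a b mc mr pc pr l D → a + b ≤ D → mc ≤ D * pc + b → mr ≤ D * pr + l →
                  a + (mc + mr) ≤ D * (pc + suc pr) + l
    count-close a b mc mr pc pr l D ab≤D mc≤ mr≤ = begin
      a + (mc + mr)                      ≤⟨ +-monoʳ-≤ a (+-mono-≤ mc≤ mr≤) ⟩
      a + ((D * pc + b) + (D * pr + l))  ≡⟨ solve 6 (λ a b pc pr l D → a :+ ((D :* pc :+ b) :+ (D :* pr :+ l))
                                                         := (a :+ b) :+ (D :* pc :+ D :* pr :+ l)) refl a b pc pr l D ⟩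
      (a + b) + (D * pc + D * pr + l)    ≤⟨ +-monoˡ-≤ _ ab≤D ⟩
      D + (D * pc + D * pr + l)          ≡⟨ solve 4 (λ pc pr l D → D :+ (D :* pc :+ D :* pr :+ l)
                                                         := D :* (pc :+ (con 1 :+ pr)) :+ l) refl pc pr l D ⟩
      D * (pc + suc pr) + l              ∎

    -- Keeping the merged remainder a + b and continuing with it.
    count-merge : ∀ a b mc mr pc pr l D → mc ≤ D * pc + b → (a + b) + mr ≤ D * pr + l →
                  a + (mc + mr) ≤ D * (pc + pr) + l
    count-merge a b mc mr pc pr l D mc≤ abmr≤ = begin
      a + (mc + mr)             ≤⟨ +-monoʳ-≤ a (+-monoˡ-≤ mr mc≤) ⟩
      a + ((D * pc + b) + mr)   ≡⟨ solve 5 (λ a b mr pc D → a :+ ((D :* pc :+ b) :+ mr)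
                                                := D :* pc :+ ((a :+ b) :+ mr)) refl a b mr pc D ⟩
      D * pc + ((a + b) + mr)   ≤⟨ +-monoʳ-≤ (D * pc) abmr≤ ⟩
      D * pc + (D * pr + l)     ≡⟨ solve 4 (λ pc pr l D → D :* pc :+ (D :* pr :+ l) := D :* (pc :+ pr) :+ l) refl pc pr l D ⟩
      D * (pc + pr) + l         ∎

    -- The marks a of a root that alone form a piece.
    count-root : ∀ a mr pr l D → a ≤ D → mr ≤ D * pr + l → a + mr ≤ D * suc pr + l
    count-root a mr pr l D a≤D mr≤ = begin
      a + mr              ≤⟨ +-mono-≤ a≤D mr≤ ⟩
      D + (D * pr + l)    ≡⟨ solve 3 (λ pr l D → D :+ (D :* pr :+ l) := D :* (con 1 :+ pr) :+ l) refl pr l D ⟩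
      D * suc pr + l      ∎

    count-leaf : ∀ a D → a + 0 ≤ D * 0 + a
    count-leaf a D = ≤-reflexive (solve 2 (λ a D → a :+ con 0 := D :* con 0 :+ a) refl a D)

  -- Rooted trees in G - v, and cutting them into fans.  Every tree vertex u
  -- carries a mark: one edge from u to v, if u is a neighbour of v.  A tree
  -- with M marks is cut (cut-tree) into edge-disjoint fans with at least r
  -- spokes each, plus a remainder with fewer than r spokes, such that
  -- M ≤ 2r · (number of fans) + (spokes of the remainder).
  module Trees (G : Graph) (v : Fin (n G)) where
    open Fans G v
    open CommutativeMonoidSolver (++-commutativeMonoid {A = E}) using (solve; _⊜_; _⊕_; id)

    -- The search for an edge from u to v; it is the one defining N_G(v).
    joins? : ∀ u e → Dec (Joins G e u v)
    joins? u e = ((e₁ e ≟ u) ×-dec (e₂ e ≟ v)) ⊎-dec ((e₁ e ≟ v) ×-dec (e₂ e ≟ u))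

    markFrom : ∀ {u} → Dec (∃ λ e → Joins G e u v) → List E
    markFrom (yes (e , _)) = e ∷ []
    markFrom (no _)        = []

    marksOf : V → List E
    marksOf u = markFrom (any? (joins? u))

    marks-join : ∀ {u t} → t ∈ marksOf u → Joins G t u v
    marks-join {u} = joining (any? (joins? u))
      where
      joining : (d : Dec (∃ λ e → Joins G e u v)) → ∀ {t} → t ∈ markFrom d → Joins G t u v
      joining (yes (e , joins)) (here refl) = joins

    marks-≤1 : ∀ u → length (marksOf u) ≤ 1
    marks-≤1 u with any? (joins? u)
    ... | yes _ = s≤s z≤n
    ... | no  _ = z≤n

    marks-unique : ∀ u → Unique (marksOf u)
    marks-unique u with any? (joins? u)
    ... | yes _ = [] ∷ []
    ... | no  _ = []

    marks-neighbour : ∀ {u} → u ∈ₛ Nbhd G v → ∃ λ t → t ∈ marksOf u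
    marks-neighbour {u} u∈N = marked (any? (joins? u)) (trans (sym (lookup∘tabulate _ u)) ([]=⇒lookup u∈N))
      where
      marked : (d : Dec (∃ λ e → Joins G e u v)) → does d ≡ true → ∃ λ t → t ∈ markFrom d
      marked (yes (e , _)) _ = e , here refl

    -- G has no loops, so no vertex is its own neighbour.
    neighbour≢v : ∀ {u} → u ∈ₛ Nbhd G v → u ≢ v
    neighbour≢v u∈N refl with marks-neighbour u∈N
    ... | t , t∈ with marks-join t∈
    ...   | inj₁ (e₁≡u , e₂≡v) = loopless G t (trans e₁≡u (sym e₂≡v))
    ...   | inj₂ (e₁≡v , e₂≡u) = loopless G t (trans e₁≡v (sym e₂≡u))

    flip-joins : ∀ {e a b} → Joins G e a b → Joins G e b a
    flip-joins (inj₁ ends) = inj₂ ends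
    flip-joins (inj₂ ends) = inj₁ ends

    data Tree : Set where
      node : V → List (E × Tree) → Tree

    root : Tree → V
    root (node w _) = w

    items : Tree → List E
    itemsC : List (E × Tree) → List E
    items (node w cs) = marksOf w ++ itemsC cs
    itemsC []             = []
    itemsC ((e , c) ∷ cs) = (e ∷ items c) ++ itemsC cs

    marksT : Tree → ℕ
    marksC : List (E × Tree) → ℕ
    marksT (node w cs) = length (marksOf w) + marksC cs
    marksC []             = 0
    marksC ((e , c) ∷ cs) = marksT c + marksC cs

    IsTree : Tree → Set
    IsTreeC : V → List (E × Tree) → Set
    IsTree (node w cs) = w ≢ v × IsTreeC w cs
    IsTreeC w []             = ⊤
    IsTreeC w ((e , c) ∷ cs) = Joins G e w (root c) × Avoid e × IsTree c × IsTreeC w cs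

    marks-fan : ∀ w → Fan w (marksOf w) []
    marks-fan w = record { grows = tt ; avoids = [] ; spokes = All.tabulate λ t∈ → w , here refl , flip-joins (marks-join t∈) }

    empty-fan : ∀ w → Fan w [] []
    empty-fan w = record { grows = tt ; avoids = [] ; spokes = [] }

    record Piece (r : ℕ) : Set where
      constructor piece
      field
        apex   : V
        spokes : List E
        tree   : List E
        apex≢v : apex ≢ v
        fan    : Fan apex spokes tree
        enough : r ≤ length spokes

    pieceEdges : ∀ {r} → Piece r → List E
    pieceEdges p = Piece.spokes p ++ Piece.tree p

    allEdges : ∀ {r} → List (Piece r) → List E
    allEdges ps = concat (map pieceEdges ps)

    allEdges-++ : ∀ {r} (ps qs : List (Piece r)) → allEdges (ps ++ qs) ≡ allEdges ps ++ allEdges qs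
    allEdges-++ ps qs = trans (cong concat (map-++ pieceEdges ps qs)) (sym (concat-++ (map pieceEdges ps) (map pieceEdges qs)))

    -- Cutting into pieces with at least r spokes; r > 0 lets every cut start
    -- from the empty remainder.
    module Cutting (r : ℕ) (r>0 : 0 < r) where
      open Counting
      open PermutationReasoning

      -- The cut of the items src, carrying `marks` marks, of a tree rooted at
      -- w: pieces, and a remainder fan at w with fewer than r spokes; together
      -- they use every item exactly once.
      record Cut (w : V) (src : List E) (marks : ℕ) : Set where
        constructor cut
        field
          pieces : List (Piece r)
          restT  : List E
          restF  : List E
          rest   : Fan w restT restF
          rest<r : length restT < r
          count  : marks ≤ (r + r) * length pieces + length restT
          perm   : allEdges pieces ++ restT ++ restF ↭ src

      -- A subtree's remainder, merged through e with the current remainder at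
      -- w, reaches r spokes: the merged fan becomes a piece, and the cut of the
      -- following subtrees started afresh is appended.
      close-piece : ∀ {w x e aT aF srcc mc src m} → w ≢ v → Joins G e w x → Avoid e →
                    Fan w aT aF → length aT < r → (child : Cut x srcc mc) →
                    r ≤ length (aT ++ Cut.restT child) → Cut w src m →
                    Cut w (aT ++ aF ++ (e ∷ srcc) ++ src) (length aT + (mc + m))
      close-piece {w} {x} {e} {aT} {aF} {srcc} {mc} {src} {m} w≢v joins avoid fa a<r
                  (cut pc bT bF fb b<r count-c perm-c) enough (cut pr lT lF fl l<r count-r perm-r) =
        cut (pc ++ P ∷ pr) lT lF fl l<r count perm
        where
        P : Piece r
        P = piece w (aT ++ bT) (aF ++ e ∷ bF) w≢v (fan-join joins avoid fa fb) enough
        count : length aT + (mc + m) ≤ (r + r) * length (pc ++ P ∷ pr) + length lT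
        count = subst (λ z → length aT + (mc + m) ≤ (r + r) * z + length lT) (sym (length-++ pc))
                  (count-close (length aT) (length bT) mc m (length pc) (length pr) (length lT) (r + r)
                     (+-mono-≤ (<⇒≤ a<r) (<⇒≤ b<r)) count-c count-r)
        perm : allEdges (pc ++ P ∷ pr) ++ lT ++ lF ↭ aT ++ aF ++ (e ∷ srcc) ++ src
        perm = begin
          allEdges (pc ++ P ∷ pr) ++ lT ++ lF
            ≡⟨ cong (_++ lT ++ lF) (allEdges-++ pc (P ∷ pr)) ⟩
          (allEdges pc ++ ((aT ++ bT) ++ (aF ++ (e ∷ []) ++ bF)) ++ allEdges pr) ++ lT ++ lF
            ↭⟨ solve 9 (λ Pc A B AF Ε BF Pr L LF →
                 (Pc ⊕ ((A ⊕ B) ⊕ (AF ⊕ (Ε ⊕ BF))) ⊕ Pr) ⊕ (L ⊕ LF)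
                 ⊜ A ⊕ (AF ⊕ ((Ε ⊕ (Pc ⊕ (B ⊕ BF))) ⊕ (Pr ⊕ (L ⊕ LF)))))
                 ↭-refl (allEdges pc) aT bT aF (e ∷ []) bF (allEdges pr) lT lF ⟩
          aT ++ aF ++ ((e ∷ []) ++ allEdges pc ++ bT ++ bF) ++ (allEdges pr ++ lT ++ lF)
            ↭⟨ ++⁺ˡ aT (++⁺ˡ aF (++⁺ (++⁺ˡ (e ∷ []) perm-c) perm-r)) ⟩
          aT ++ aF ++ (e ∷ srcc) ++ src ∎

      -- A subtree's remainder, merged through e with the current remainder,
      -- stays below r spokes: the cut of the following subtrees continues from
      -- the merged remainder.
      merge-rest : ∀ {w x e aT aF srcc mc src m} → (child : Cut x srcc mc) →
                   Cut w ((aT ++ Cut.restT child) ++ (aF ++ e ∷ Cut.restF child) ++ src) (length (aT ++ Cut.restT child) + m) →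
                   Cut w (aT ++ aF ++ (e ∷ srcc) ++ src) (length aT + (mc + m))
      merge-rest {w} {x} {e} {aT} {aF} {srcc} {mc} {src} {m}
                 (cut pc bT bF fb b<r count-c perm-c) (cut pr lT lF fl l<r count-r perm-r) =
        cut (pc ++ pr) lT lF fl l<r count perm
        where
        count : length aT + (mc + m) ≤ (r + r) * length (pc ++ pr) + length lT
        count = subst (λ z → length aT + (mc + m) ≤ (r + r) * z + length lT) (sym (length-++ pc))
                  (count-merge (length aT) (length bT) mc m (length pc) (length pr) (length lT) (r + r) count-c
                     (subst (λ z → z + m ≤ (r + r) * length pr + length lT) (length-++ aT) count-r))
        perm : allEdges (pc ++ pr) ++ lT ++ lF ↭ aT ++ aF ++ (e ∷ srcc) ++ src
        perm = begin
          allEdges (pc ++ pr) ++ lT ++ lF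
            ≡⟨ cong (_++ lT ++ lF) (allEdges-++ pc pr) ⟩
          (allEdges pc ++ allEdges pr) ++ lT ++ lF
            ↭⟨ solve 4 (λ Pc Pr L LF → (Pc ⊕ Pr) ⊕ (L ⊕ LF) ⊜ Pc ⊕ (Pr ⊕ (L ⊕ LF))) ↭-refl (allEdges pc) (allEdges pr) lT lF ⟩
          allEdges pc ++ (allEdges pr ++ lT ++ lF)
            ↭⟨ ++⁺ˡ (allEdges pc) perm-r ⟩
          allEdges pc ++ ((aT ++ bT) ++ (aF ++ (e ∷ []) ++ bF) ++ src)
            ↭⟨ solve 7 (λ Pc A B AF Ε BF S →
                 Pc ⊕ ((A ⊕ B) ⊕ ((AF ⊕ (Ε ⊕ BF)) ⊕ S))
                 ⊜ A ⊕ (AF ⊕ ((Ε ⊕ (Pc ⊕ (B ⊕ BF))) ⊕ S)))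
                 ↭-refl (allEdges pc) aT bT aF (e ∷ []) bF src ⟩
          aT ++ aF ++ ((e ∷ []) ++ allEdges pc ++ bT ++ bF) ++ src
            ↭⟨ ++⁺ˡ aT (++⁺ˡ aF (++⁺ʳ src (++⁺ˡ (e ∷ []) perm-c))) ⟩
          aT ++ aF ++ (e ∷ srcc) ++ src ∎

      -- Cutting proceeds bottom-up: the subtrees are cut first, and their
      -- remainders are merged one by one into a remainder at the root.
      cut-tree : (t : Tree) → IsTree t → Cut (root t) (items t) (marksT t)
      cut-children : ∀ w → w ≢ v → ∀ aT aF → Fan w aT aF → length aT < r → ∀ cs → IsTreeC w cs →
                     Cut w (aT ++ aF ++ itemsC cs) (length aT + marksC cs)

      cut-tree (node w cs) (w≢v , valid) with r ≤? length (marksOf w)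
      ... | no  few    = cut-children w w≢v (marksOf w) [] (marks-fan w) (≰⇒> few) cs valid
      ... | yes enough = root-piece (cut-children w w≢v [] [] (empty-fan w) r>0 cs valid)
        where
        root-piece : Cut w (itemsC cs) (marksC cs) → Cut w (marksOf w ++ itemsC cs) (length (marksOf w) + marksC cs)
        root-piece (cut ps lT lF fl l<r count perm) =
          cut (piece w (marksOf w) [] w≢v (marks-fan w) enough ∷ ps) lT lF fl l<r
              (count-root (length (marksOf w)) (marksC cs) (length ps) (length lT) (r + r)
                 (≤-trans (marks-≤1 w) (≤-trans r>0 (m≤m+n r r))) count)
              perm′
          where
          perm′ : allEdges (piece w (marksOf w) [] w≢v (marks-fan w) enough ∷ ps) ++ lT ++ lF ↭ marksOf w ++ itemsC cs
          perm′ = begin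
            ((marksOf w ++ []) ++ allEdges ps) ++ lT ++ lF
              ↭⟨ solve 4 (λ M Ps L LF → ((M ⊕ id) ⊕ Ps) ⊕ (L ⊕ LF) ⊜ M ⊕ (Ps ⊕ (L ⊕ LF))) ↭-refl (marksOf w) (allEdges ps) lT lF ⟩
            marksOf w ++ allEdges ps ++ lT ++ lF
              ↭⟨ ++⁺ˡ (marksOf w) perm ⟩
            marksOf w ++ itemsC cs ∎

      cut-children w w≢v aT aF fa a<r [] _ =
        cut [] aT aF fa a<r (count-leaf (length aT) (r + r))
            (solve 2 (λ A AF → id ⊕ (A ⊕ AF) ⊜ A ⊕ (AF ⊕ id)) ↭-refl aT aF)
      cut-children w w≢v aT aF fa a<r ((e , c) ∷ cs) (joins , avoid , valid-c , valid-cs) =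
        continue (cut-tree c valid-c)
        where
        continue : Cut (root c) (items c) (marksT c) → Cut w (aT ++ aF ++ itemsC ((e , c) ∷ cs)) (length aT + marksC ((e , c) ∷ cs))
        continue child with r ≤? length (aT ++ Cut.restT child)
        ... | yes enough =
          close-piece w≢v joins avoid fa a<r child enough (cut-children w w≢v [] [] (empty-fan w) r>0 cs valid-cs)
        ... | no  few    =
          merge-rest {aT = aT} {aF} child (cut-children w w≢v (aT ++ Cut.restT child) (aF ++ e ∷ Cut.restF child)
                              (fan-join joins avoid fa (Cut.rest child)) (≰⇒> few) cs valid-cs)

  -- Spanning trees of G - v, grown from one vertex by attaching new leaves
  -- along edges that leave the tree, until no edge of G - v leaves it.  When
  -- G - v is connected the final tree contains every vertex other than v,
  -- hence all neighbours of v, so it carries at least deg(v) marks.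
  module SpanningTrees (G : Graph) (v : Fin (n G)) where
    open Fans G v
    open Trees G v
    open CommutativeMonoidSolver (++-commutativeMonoid {A = E}) using (solve; _⊜_; _⊕_)
    open CommutativeMonoidSolver (++-commutativeMonoid {A = V}) using () renaming (solve to solveᵥ; _⊜_ to _⊜ᵥ_; _⊕_ to _⊕ᵥ_)

    vertsT : Tree → List V
    vertsC : List (E × Tree) → List V
    vertsT (node w cs) = w ∷ vertsC cs
    vertsC []             = []
    vertsC ((e , c) ∷ cs) = vertsT c ++ vertsC cs

    record Grafted (t : Tree) (w : V) (e : E) (s : Tree) : Set where
      constructor grafted
      field
        result      : Tree
        same-root   : root result ≡ root t
        items-perm  : items result ↭ items t ++ (e ∷ items s)
        verts-perm  : vertsT result ↭ vertsT t ++ vertsT s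
        still-tree  : IsTree t → Joins G e w (root s) → Avoid e → IsTree s → IsTree result

    record GraftedC (cs : List (E × Tree)) (w : V) (e : E) (s : Tree) : Set where
      constructor graftedC
      field
        result      : List (E × Tree)
        items-perm  : itemsC result ↭ itemsC cs ++ (e ∷ items s)
        verts-perm  : vertsC result ↭ vertsC cs ++ vertsT s
        still-tree  : ∀ u → IsTreeC u cs → Joins G e w (root s) → Avoid e → IsTree s → IsTreeC u result

    graft : (t : Tree) (w : V) → w ∈ vertsT t → (e : E) (s : Tree) → Grafted t w e s
    graftC : (cs : List (E × Tree)) (w : V) → w ∈ vertsC cs → (e : E) (s : Tree) → GraftedC cs w e s

    graft (node y cs) w (here refl) e s =
      grafted (node y ((e , s) ∷ cs)) refl
        (solve 4 (λ M Ε S C → M ⊕ ((Ε ⊕ S) ⊕ C) ⊜ (M ⊕ C) ⊕ (Ε ⊕ S)) ↭-refl (marksOf y) (e ∷ []) (items s) (itemsC cs))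
        (↭-prep y (++-comm (vertsT s) (vertsC cs)))
        (λ { (y≢v , valid) joins avoid valid-s → y≢v , joins , avoid , valid-s , valid })
    graft (node y cs) w (there w∈cs) e s with graftC cs w w∈cs e s
    ... | graftedC cs′ items-perm verts-perm still-tree =
      grafted (node y cs′) refl
        (↭-trans (++⁺ˡ (marksOf y) items-perm)
                 (solve 3 (λ M C S → M ⊕ (C ⊕ S) ⊜ (M ⊕ C) ⊕ S) ↭-refl (marksOf y) (itemsC cs) (e ∷ items s)))
        (↭-prep y verts-perm)
        (λ { (y≢v , valid) joins avoid valid-s → y≢v , still-tree y valid joins avoid valid-s })

    graftC ((e′ , c) ∷ cs) w w∈ e s with ∈-++⁻ (vertsT c) w∈
    ... | inj₁ w∈c with graft c w w∈c e s
    ...   | grafted c′ same-root items-perm verts-perm still-tree =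
      graftedC ((e′ , c′) ∷ cs)
        (↭-trans (++⁺ʳ (itemsC cs) (↭-prep e′ items-perm))
                 (solve 4 (λ Ε′ C S Cs → (Ε′ ⊕ (C ⊕ S)) ⊕ Cs ⊜ (Ε′ ⊕ (C ⊕ Cs)) ⊕ S) ↭-refl (e′ ∷ []) (items c) (e ∷ items s) (itemsC cs)))
        (↭-trans (++⁺ʳ (vertsC cs) verts-perm)
                 (solveᵥ 3 (λ C S Cs → (C ⊕ᵥ S) ⊕ᵥ Cs ⊜ᵥ (C ⊕ᵥ Cs) ⊕ᵥ S)
                    ↭-refl (vertsT c) (vertsT s) (vertsC cs)))
        (λ { u (joins′ , avoid′ , valid-c , valid-cs) joins avoid valid-s →
               subst (Joins G e′ u) (sym same-root) joins′ , avoid′ , still-tree valid-c joins avoid valid-s , valid-cs })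
    graftC ((e′ , c) ∷ cs) w w∈ e s | inj₂ w∈cs with graftC cs w w∈cs e s
    ... | graftedC cs′ items-perm verts-perm still-tree =
      graftedC ((e′ , c) ∷ cs′)
        (↭-trans (++⁺ˡ (e′ ∷ items c) items-perm)
                 (solve 3 (λ C Cs S → C ⊕ (Cs ⊕ S) ⊜ (C ⊕ Cs) ⊕ S) ↭-refl (e′ ∷ items c) (itemsC cs) (e ∷ items s)))
        (↭-trans (++⁺ˡ (vertsT c) verts-perm)
                 (solveᵥ 3 (λ C Cs S → C ⊕ᵥ (Cs ⊕ᵥ S) ⊜ᵥ (C ⊕ᵥ Cs) ⊕ᵥ S)
                    ↭-refl (vertsT c) (vertsC cs) (vertsT s)))
        (λ { u (joins′ , avoid′ , valid-c , valid-cs) joins avoid valid-s →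
               joins′ , avoid′ , valid-c , still-tree u valid-cs joins avoid valid-s })

    record GoodTree (t : Tree) : Set where
      field
        valid        : IsTree t
        items-unique : Unique (items t)
        verts-unique : Unique (vertsT t)
        verts≢v      : All (_≢ v) (vertsT t)
        items-inside : ∀ {i} → i ∈ items t →
                       (Σ V λ u → u ∈ vertsT t × Joins G i u v) ⊎ (e₁ i ∈ vertsT t × e₂ i ∈ vertsT t)

    ∈-leaf-items : ∀ {x i} → i ∈ items (node x []) → i ∈ marksOf x
    ∈-leaf-items {x} = subst (_ ∈_) (++-identityʳ (marksOf x))

    singleton-good : ∀ {s} → s ≢ v → GoodTree (node s [])
    singleton-good {s} s≢v = record
      { valid        = s≢v , tt
      ; items-unique = subst Unique (sym (++-identityʳ (marksOf s))) (marks-unique s)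
      ; verts-unique = [] ∷ []
      ; verts≢v      = s≢v ∷ []
      ; items-inside = λ i∈ → inj₁ (s , here refl , marks-join (∈-leaf-items i∈))
      }

    joins-v-unique : ∀ {i x u} → Joins G i x v → Joins G i u v → x ≢ v → u ≢ v → x ≡ u
    joins-v-unique (inj₁ (i₁≡x , _)) (inj₁ (i₁≡u , _)) _   _   = trans (sym i₁≡x) i₁≡u
    joins-v-unique (inj₁ (i₁≡x , _)) (inj₂ (i₁≡v , _)) x≢v _   = ⊥-elim (x≢v (trans (sym i₁≡x) i₁≡v))
    joins-v-unique (inj₂ (i₁≡v , _)) (inj₁ (i₁≡u , _)) _   u≢v = ⊥-elim (u≢v (trans (sym i₁≡u) i₁≡v))
    joins-v-unique (inj₂ (_ , i₂≡x)) (inj₂ (_ , i₂≡u)) _   _   = trans (sym i₂≡x) i₂≡u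

    joins-avoid : ∀ {e w x} → w ≢ v → x ≢ v → Joins G e w x → Avoid e
    joins-avoid w≢v x≢v joins = ends-from (_≢ v) joins w≢v x≢v

    -- The items brought by a new leaf x, the edge e to it and the mark of x,
    -- are distinct and new: e has the new end x, and a mark of x would
    -- otherwise be an item at a tree vertex, but a mark determines its vertex.
    leaf-items-new : ∀ {t} → GoodTree t → ∀ {e w x} → w ∈ vertsT t → x ∉ vertsT t → x ≢ v → Joins G e w x →
                     Unique (e ∷ items (node x [])) × (∀ {i} → i ∈ items t × i ∈ e ∷ items (node x []) → Data.Empty.⊥)
    leaf-items-new {t} good {e} {w} {x} w∈t x∉t x≢v joins = new-unique , fresh
      where
      open GoodTree good
      avoid : Avoid e
      avoid = joins-avoid (All.lookup verts≢v w∈t) x≢v joins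
      new-unique : Unique (e ∷ items (node x []))
      new-unique = All.tabulate (λ i∈ e≡i → Touch⇒≢Avoid (Joins⇒Touch (flip-joins (marks-join (∈-leaf-items i∈)))) avoid (sym e≡i))
                 ∷ subst Unique (sym (++-identityʳ (marksOf x))) (marks-unique x)
      fresh : ∀ {i} → i ∈ items t × i ∈ e ∷ items (node x []) → Data.Empty.⊥
      fresh (i∈t , here refl) with items-inside i∈t
      ... | inj₁ (_ , _ , i-joins) = Touch⇒≢Avoid (Joins⇒Touch (flip-joins i-joins)) avoid refl
      ... | inj₂ (e₁∈t , e₂∈t)     = x∉t (end-to (_∈ vertsT t) joins e₁∈t e₂∈t)
      fresh (i∈t , there i∈x) with items-inside i∈t | marks-join (∈-leaf-items i∈x)
      ... | inj₁ (u , u∈t , i-joins) | x-joins =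
        x∉t (subst (_∈ vertsT t) (sym (joins-v-unique x-joins i-joins x≢v (All.lookup verts≢v u∈t))) u∈t)
      ... | inj₂ (_ , e₂∈t) | inj₁ (_ , i₂≡v) = All.lookup verts≢v e₂∈t i₂≡v
      ... | inj₂ (e₁∈t , _) | inj₂ (i₁≡v , _) = All.lookup verts≢v e₁∈t i₁≡v

    add-leaf : ∀ {t} → GoodTree t → ∀ {e w x} → w ∈ vertsT t → x ∉ vertsT t → x ≢ v → Joins G e w x →
               Σ Tree λ t′ → GoodTree t′ × root t′ ≡ root t × length (vertsT t′) ≡ suc (length (vertsT t))
    add-leaf {t} good {e} {w} {x} w∈t x∉t x≢v joins = result , good′ , same-root , size
      where
      open GoodTree good
      open Grafted (graft t w w∈t e (node x []))
      avoid : Avoid e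
      avoid = joins-avoid (All.lookup verts≢v w∈t) x≢v joins
      in-result : ∀ {y} → y ∈ vertsT t ++ x ∷ [] → y ∈ vertsT result
      in-result = ∈-resp-↭ (↭-sym verts-perm)
      w∈ : w ∈ vertsT result
      w∈ = in-result (∈-++⁺ˡ w∈t)
      x∈ : x ∈ vertsT result
      x∈ = in-result (∈-++⁺ʳ (vertsT t) (here refl))
      located : ∀ {i} → i ∈ items t ⊎ i ∈ e ∷ items (node x []) →
               (Σ V λ u → u ∈ vertsT result × Joins G i u v) ⊎ (e₁ i ∈ vertsT result × e₂ i ∈ vertsT result)
      located (inj₁ i∈t) with items-inside i∈t
      ... | inj₁ (u , u∈t , i-joins) = inj₁ (u , in-result (∈-++⁺ˡ u∈t) , i-joins)
      ... | inj₂ (e₁∈t , e₂∈t)       = inj₂ (in-result (∈-++⁺ˡ e₁∈t) , in-result (∈-++⁺ˡ e₂∈t))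
      located (inj₂ (here refl)) = inj₂ (ends-from (_∈ vertsT result) joins w∈ x∈)
      located (inj₂ (there i∈x)) = inj₁ (x , x∈ , marks-join (∈-leaf-items i∈x))
      good′ : GoodTree result
      good′ = record
        { valid        = still-tree valid joins avoid (x≢v , tt)
        ; items-unique = Unique-resp-↭ (↭-sym items-perm) (Data.Product.uncurry (Unique.++⁺ items-unique) (leaf-items-new good w∈t x∉t x≢v joins))
        ; verts-unique = Unique-resp-↭ (↭-sym verts-perm) (Unique.++⁺ verts-unique ([] ∷ []) λ { (x∈t , here refl) → x∉t x∈t })
        ; verts≢v      = All-resp-↭ (↭-sym verts-perm) (All.++⁺ verts≢v (x≢v ∷ []))
        ; items-inside = located ∘ ∈-++⁻ (items t) ∘ ∈-resp-↭ items-perm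
        }
      size : length (vertsT result) ≡ suc (length (vertsT t))
      size = trans (↭-length verts-perm) (trans (length-++ (vertsT t)) (+-comm (length (vertsT t)) 1))

    open DecMembership (_≟_ {n G}) using (_∈?_)

    Leaving : Tree → E → Set
    Leaving t e = (e₁ e ∈ vertsT t × e₂ e ∉ vertsT t × e₂ e ≢ v) ⊎ (e₂ e ∈ vertsT t × e₁ e ∉ vertsT t × e₁ e ≢ v)

    leaving? : ∀ t e → Dec (Leaving t e)
    leaving? t e = ((e₁ e ∈? vertsT t) ×-dec (¬? (e₂ e ∈? vertsT t) ×-dec ¬? (e₂ e ≟ v)))
                   ⊎-dec ((e₂ e ∈? vertsT t) ×-dec (¬? (e₁ e ∈? vertsT t) ×-dec ¬? (e₁ e ≟ v)))

    Maximal : Tree → Set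
    Maximal t = ∀ e → ¬ Leaving t e

    record Exit (t : Tree) (e : E) : Set where
      constructor exit
      field
        {inner outer} : V
        inner∈t : inner ∈ vertsT t
        outer∉t : outer ∉ vertsT t
        outer≢v : outer ≢ v
        joins   : Joins G e inner outer

    leaving-exit : ∀ {t e} → Leaving t e → Exit t e
    leaving-exit (inj₁ (e₁∈t , e₂∉t , e₂≢v)) = exit e₁∈t e₂∉t e₂≢v (inj₁ (refl , refl))
    leaving-exit (inj₂ (e₂∈t , e₁∉t , e₁≢v)) = exit e₂∈t e₁∉t e₁≢v (inj₂ (refl , refl))

    room : ∀ {t x} → GoodTree t → x ∉ vertsT t → suc (length (vertsT t)) ≤ n G
    room {t} {x} good x∉t = subst (suc (length (vertsT t)) ≤_) (∣⊤∣≡n (n G))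
      (length≤∣p∣ ⊤ₛ (x ∷ vertsT t) (All.tabulate (λ y∈t x≡y → x∉t (subst (_∈ vertsT t) (sym x≡y) y∈t)) ∷ GoodTree.verts-unique good)
                  (λ _ → ∈⊤))

    -- Attach leaves while some edge leaves the tree; the fuel f bounds the
    -- number of vertices still missing.
    grow : ∀ f t → GoodTree t → n G ≤ length (vertsT t) + f → Σ Tree λ t′ → GoodTree t′ × root t′ ≡ root t × Maximal t′
    grow f t good fuel with any? (leaving? t)
    ... | no  none          = t , good , refl , λ e leaving → none (e , leaving)
    ... | yes (e , leaving) = attach f fuel (leaving-exit leaving)
      where
      attach : ∀ f → n G ≤ length (vertsT t) + f → Exit t e → Σ Tree λ t′ → GoodTree t′ × root t′ ≡ root t × Maximal t′
      attach zero fuel (exit _ outer∉t _ _) =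
        ⊥-elim (<-irrefl refl (≤-trans (room good outer∉t) (subst (n G ≤_) (+-identityʳ _) fuel)))
      attach (suc f) fuel (exit inner∈t outer∉t outer≢v joins) = continue (add-leaf good inner∈t outer∉t outer≢v joins)
        where
        continue : (Σ Tree λ t′ → GoodTree t′ × root t′ ≡ root t × length (vertsT t′) ≡ suc (length (vertsT t))) →
                   Σ Tree λ t″ → GoodTree t″ × root t″ ≡ root t × Maximal t″
        continue (t′ , good′ , root′ , size′)
          with grow f t′ good′ (subst (λ z → n G ≤ z + f) (sym size′) (subst (n G ≤_) (+-suc _ f) fuel))
        ... | t″ , good″ , root″ , maximal = t″ , good″ , trans root″ root′ , maximal

    maximal-closed : ∀ {t} → Maximal t → ∀ {a b} → Path G (⊤ₛ -ₛ v) a b → a ∈ vertsT t → b ∈ vertsT t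
    maximal-closed maximal here                       a∈t = a∈t
    maximal-closed {t} maximal (step {x = x} e joins x∈S rest) a∈t with x ∈? vertsT t
    ... | yes x∈t = maximal-closed maximal rest x∈t
    ... | no  x∉t = ⊥-elim (maximal e (leaves joins))
      where
      x≢v : x ≢ v
      x≢v refl = x∉p-x ⊤ₛ x x∈S
      leaves : Joins G e _ x → Leaving t e
      leaves (inj₁ (e₁≡a , e₂≡x)) = inj₁ (subst (_∈ _) (sym e₁≡a) a∈t , subst (_∉ _) (sym e₂≡x) x∉t , subst (_≢ v) (sym e₂≡x) x≢v)
      leaves (inj₂ (e₁≡x , e₂≡a)) = inj₂ (subst (_∈ _) (sym e₂≡a) a∈t , subst (_∉ _) (sym e₁≡x) x∉t , subst (_≢ v) (sym e₁≡x) x≢v)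

    spanning-tree : ConnectedOn G (⊤ₛ -ₛ v) → ∀ {s} → s ≢ v →
                    Σ Tree λ t → GoodTree t × (∀ u → u ≢ v → u ∈ vertsT t)
    spanning-tree connected {s} s≢v with grow (n G) (node s []) (singleton-good s≢v) (n≤1+n (n G))
    ... | t , good , root≡s , maximal = t , good , spans
      where
      root∈ : ∀ t → root t ∈ vertsT t
      root∈ (node w _) = here refl
      spans : ∀ u → u ≢ v → u ∈ vertsT t
      spans u u≢v = maximal-closed maximal
        (connected s u (x∈p∧x≢y⇒x∈p-y ∈⊤ s≢v) (x∈p∧x≢y⇒x∈p-y ∈⊤ u≢v)) (subst (_∈ vertsT t) root≡s (root∈ t))

    markedT : Tree → List V
    markedC : List (E × Tree) → List V
    markedT (node w cs) = map (λ _ → w) (marksOf w) ++ markedC cs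
    markedC []             = []
    markedC ((e , c) ∷ cs) = markedT c ++ markedC cs

    length-markedT : ∀ t → length (markedT t) ≡ marksT t
    length-markedC : ∀ cs → length (markedC cs) ≡ marksC cs
    length-markedT (node w cs) = trans (length-++ (map (λ _ → w) (marksOf w))) (cong₂ _+_ (length-map _ (marksOf w)) (length-markedC cs))
    length-markedC []             = refl
    length-markedC ((e , c) ∷ cs) = trans (length-++ (markedT c)) (cong₂ _+_ (length-markedT c) (length-markedC cs))

    neighbour-markedT : ∀ t {u} → u ∈ vertsT t → u ∈ₛ Nbhd G v → u ∈ markedT t
    neighbour-markedC : ∀ cs {u} → u ∈ vertsC cs → u ∈ₛ Nbhd G v → u ∈ markedC cs
    neighbour-markedT (node w cs) (here refl) u∈N = ∈-++⁺ˡ (∈-map⁺ (λ _ → w) (proj₂ (marks-neighbour u∈N)))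
    neighbour-markedT (node w cs) (there u∈cs) u∈N = ∈-++⁺ʳ (map (λ _ → w) (marksOf w)) (neighbour-markedC cs u∈cs u∈N)
    neighbour-markedC ((e , c) ∷ cs) u∈ u∈N with ∈-++⁻ (vertsT c) u∈
    ... | inj₁ u∈c  = ∈-++⁺ˡ (neighbour-markedT c u∈c u∈N)
    ... | inj₂ u∈cs = ∈-++⁺ʳ (markedT c) (neighbour-markedC cs u∈cs u∈N)

    deg≤marks : ∀ t → (∀ u → u ≢ v → u ∈ vertsT t) → deg G v ≤ marksT t
    deg≤marks t spans = subst (deg G v ≤_) (length-markedT t)
      (∣p∣≤length (Nbhd G v) (markedT t) λ u∈N → neighbour-markedT t (spans _ (neighbour≢v u∈N)) u∈N)

  maximum-witness : ∀ {A : Set} (L : List A) (f : A → ℕ) b → 0 < b → b ≤ foldr _⊔_ 0 (map f L) → Σ A λ x → b ≤ f x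
  maximum-witness []      f b b>0 b≤0 = ⊥-elim (<-irrefl refl (≤-trans b>0 b≤0))
  maximum-witness (x ∷ L) f b b>0 b≤max with b ≤? f x | ⊔-sel (f x) (foldr _⊔_ 0 (map f L))
  ... | yes b≤fx | _         = x , b≤fx
  ... | no  b≰fx | inj₁ max≡ = ⊥-elim (b≰fx (subst (b ≤_) max≡ b≤max))
  ... | no  _    | inj₂ max≡ = maximum-witness L f b b>0 (subst (b ≤_) max≡ b≤max)

  high-degree-vertex : ∀ G {b} → 0 < b → b ≤ Δ G → Σ (Fin (n G)) λ v → b ≤ deg G v
  high-degree-vertex G b>0 b≤Δ = maximum-witness (allFin (n G)) (deg G) _ b>0 b≤Δ

  enough-pieces : ∀ k r p l → 2 * k * r ≤ (r + r) * p + l → l < r → k ≤ p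
  enough-pieces k r p l bound l<r with k ≤? p
  ... | yes k≤p = k≤p
  ... | no  k≰p = ⊥-elim (<-irrefl refl (<-≤-trans (≤-<-trans bound (+-monoʳ-< ((r + r) * p) (<-≤-trans l<r (m≤m+n r r)))) too-big))
    where
    open +-*-Solver
    too-big : (r + r) * p + (r + r) ≤ 2 * k * r
    too-big = subst₂ _≤_ (solve 2 (λ r p → (r :+ r) :* (con 1 :+ p) := (r :+ r) :* p :+ (r :+ r)) refl r p)
                         (solve 2 (λ k r → (r :+ r) :* k := con 2 :* k :* r) refl k r)
                         (*-monoʳ-≤ (r + r) (≰⇒> k≰p))

  positive : ∀ k r → 0 < k → 0 < r → 0 < 2 * k * r
  positive (suc k) (suc r) _ _ = s≤s z≤n

  module Packing (G : Graph) (v : Fin (n G)) where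
    open Fans G v
    open Trees G v
    open SpanningTrees G v

    fan-take : ∀ r {w T F} → Fan w T F → Fan w (take r T) F
    fan-take r fan = record { grows = Fan.grows fan ; avoids = Fan.avoids fan ; spokes = All.take⁺ r (Fan.spokes fan) }

    pieceSubgraph : ∀ {r} → Piece r → Subgraph G
    pieceSubgraph {r} (piece w T F _ fan _) = fanSubgraph (fan-take r fan)

    pieceSubgraph-edges : ∀ {r} (p : Piece r) {e} → e ∈ₛ EH (pieceSubgraph p) → e ∈ pieceEdges p
    pieceSubgraph-edges {r} (piece w T F _ _ _) e∈ with ∈-++⁻ (take r T) (∈toSubset⁻ e∈)
    ... | inj₁ e∈T = ∈-++⁺ˡ (∈-take r T e∈T)
    ... | inj₂ e∈F = ∈-++⁺ʳ T e∈F

    piece-model : ∀ {r} (p : Piece r) → Unique (pieceEdges p) → IsModel G r (pieceSubgraph p)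
    piece-model {r} (piece w T F w≢v fan enough) uniq =
      subst (λ z → IsModel G z (pieceSubgraph (piece w T F w≢v fan enough))) (trans (length-take r T) (m≤n⇒m⊓n≡m enough))
        (fan-model w≢v (fan-take r fan) (Unique.take⁺ r (Unique-++ˡ T uniq)) (Unique-++ʳ T uniq))

    disjoint-models : ∀ {k r} (ps : List (Piece r)) → Unique (allEdges ps) → k ≤ length ps →
                      Σ (Fin k → Subgraph G) λ H → (∀ i → IsModel G r (H i))
                        × (∀ i j → i ≢ j → ∀ e → e ∈ₛ EH (H i) → e ∉ₛ EH (H j))
    disjoint-models {k} ps uniq k≤ = H , models , disjoint
      where
      index : Fin k → Fin (length ps)
      index i = inject≤ i k≤
      index-injective : ∀ {i j} → index i ≡ index j → i ≡ j
      index-injective = inject≤-injective k≤ k≤ _ _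
      H : Fin k → Subgraph G
      H i = pieceSubgraph (lookup ps (index i))
      models : ∀ i → IsModel G _ (H i)
      models i = piece-model (lookup ps (index i)) (Unique-concat-lookup pieceEdges ps uniq (index i))
      disjoint : ∀ i j → i ≢ j → ∀ e → e ∈ₛ EH (H i) → e ∉ₛ EH (H j)
      disjoint i j i≢j e e∈i e∈j =
        Unique-concat-disjoint pieceEdges ps uniq (i≢j ∘ index-injective)
          (pieceSubgraph-edges (lookup ps (index i)) e∈i) (pieceSubgraph-edges (lookup ps (index j)) e∈j)

    some-neighbour : 0 < deg G v → ∃ λ s → s ∈ₛ Nbhd G v
    some-neighbour deg>0 with nonempty? (Nbhd G v)
    ... | yes found = found
    ... | no  none  = ⊥-elim (<-irrefl refl (≤-trans deg>0 (∣p∣≤length (Nbhd G v) [] λ s∈N → ⊥-elim (none (_ , s∈N)))))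

    packing : ∀ k r → 0 < k → 0 < r → ConnectedOn G (⊤ₛ -ₛ v) → 2 * k * r ≤ deg G v →
              Σ (Fin k → Subgraph G) λ H → (∀ i → IsModel G r (H i))
                × (∀ i j → i ≢ j → ∀ e → e ∈ₛ EH (H i) → e ∉ₛ EH (H j))
    packing k r k>0 r>0 connected 2kr≤deg with some-neighbour (<-≤-trans (positive k r k>0 r>0) 2kr≤deg)
    ... | s , s∈N with spanning-tree connected (neighbour≢v s∈N)
    ...   | t , good , spans =
      disjoint-models pieces (Unique-++ˡ (allEdges pieces) (Unique-resp-↭ (↭-sym perm) (GoodTree.items-unique good)))
        (enough-pieces k r (length pieces) (length restT) (≤-trans 2kr≤deg (≤-trans (deg≤marks t spans) count)) rest<r)
      where
      open Cutting.Cut (Cutting.cut-tree r r>0 t (GoodTree.valid good))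

open ThetaPacking using (positive; high-degree-vertex; module Packing)

open import Defs
open import Data.Nat using (ℕ; _*_; _≤_; _>_)
open import Data.Fin using (Fin)
open import Data.Fin.Subset using (_∈_; _∉_)
open import Data.Product using (Σ; _×_; _,_)
open import Relation.Binary.PropositionalEquality using (_≢_)

-- A vertex v of maximum degree has deg(v) ≥ 2kr, and G - v is connected
-- since G is biconnected; packing around v gives the k models.
lemma2 : (k r : ℕ) → k > 0 → r > 0 → (G : Graph) → Biconnected G → 2 * k * r ≤ Δ G →
    Σ (Fin k → Subgraph G) λ H →
      (∀ i → IsModel G r (H i))
      × (∀ i j → i ≢ j → ∀ e → e ∈ EH (H i) → e ∉ EH (H j))
lemma2 k r k>0 r>0 G (_ , connected-without) 2kr≤Δ with high-degree-vertex G (positive k r k>0 r>0) 2kr≤Δ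
... | v , 2kr≤deg = Packing.packing G v k r k>0 r>0 (connected-without v) 2kr≤deg
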